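{- Let $k\ge 12$ be an even integer and let $p\in W_k^-$. Define coefficients $c_{r,s}\in\mathbb{Q}$ (for integers $r,s\ge 1$ with $r+s=k-1$) by $$\frac{\partial}{\partial X}\,p(X+Y,Y)=\sum_{r+s=k-1}\binom{k-3}{r-1}\,c_{r,s}\,X^{r-1}Y^{s-1}.$$ Then in the formal double zeta space $\mathcal{D}_{k-1}$ one has $$\sum_{\substack{r+s=k-1\\ 4\le r\le k-4,\ r\text{ even}}}(c_{r,s}-c_{s,r})\,Z_{r,s}\equiv 0 \pmod{Z_{k-1}},$$ i.e. the left-hand side is a rational multiple of $Z_{k-1}$ in $\mathcal{D}_{k-1}$.
   Context: Formal double zeta space. For an integer $w>2$, $\mathcal{D}_w$ is the $\mathbb{Q}$-vector space generated by formal symbols $Z_{r,s}$, $P_{r,s}$ (for integers $r,s\ge 1$ with $r+s=w$) and $Z_w$, modulo the relations $$Z_{r,s}+Z_{s,r}=P_{r,s}-Z_w\quad (r+s=w,\ r,s\ge1),$$ $$\sum_{\substack{r+s=w\\ r,s\ge 1}}\left[\binom{r-1}{i-1}+\binom{r-1}{j-1}\right]Z_{r,s}=P_{i,j}\quad (i+j=w,\ i,j\ge1).$$ Period polynomials. For even $k$, $V_k$ is the $\mathbb{Q}$-vector space of homogeneous polynomials of degree $k-2$ in $X,Y$ with rational coefficients, and $W_k\subset V_k$ is the subspace of polynomials $P$ satisfying $P(X,Y)+P(-Y,X)=0$ and $P(X,Y)+P(X-Y,X)+P(Y,Y-X)=0$. Then $W_k=W_k^+\oplus W_k^-$, where $W_k^+$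 (resp. $W_k^-$) is the subspace of polynomials that are symmetric, $P(X,Y)=P(Y,X)$ (resp. antisymmetric, $P(X,Y)=-P(Y,X)$). -}

module Defs where

open import Algebra.Module.Bundles using (Module)
open import Algebra.Module.Structures.Biased using (IsModuleFromLeft)
open import Data.Fin.Base using (Fin; toℕ; opposite)
open import Data.Fin.Properties using (toℕ<n; opposite-prop)
open import Data.Integer.Base using (+_)
open import Data.List.Base using (List; foldr; map; allFin)
open import Data.Nat.Base as ℕ using (ℕ; zero; suc; _∸_)
open import Data.Nat.Combinatorics using (_C_)
import Data.Nat.Properties as ℕₚ
open import Data.Product.Base using (_×_; _,_)
open import Data.Rational.Base using (ℚ; 0ℚ; 1ℚ; _+_; _*_; -_; _/_)
import Data.Rational.Properties as ℚₚ
open import Data.Vec.Functional using (Vector)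
open import Level using (0ℓ)
open import Relation.Binary.Bundles using (Setoid)
open import Relation.Binary.PropositionalEquality
  using (_≡_; refl; sym; trans; cong)
import Relation.Binary.Reasoning.Setoid as ≈-Reasoning
open import Relation.Unary using (Pred; _∈_)

open import Algebra.Properties.CommutativeMonoid.Sum ℚₚ.+-0-commutativeMonoid
  using (sum)

fromℕ : ℕ → ℚ
fromℕ n = + n / 1

------------------------------------------------------------------------
-- Pairs (r , s) with r , s ≥ 1 and r + s = w

-- Such a pair is determined by r, so the pairs are enumerated by
-- x = r - 1 ∈ {0, …, w - 2}; `opposite` then exchanges r and s.

Index : ℕ → Set
Index w = Fin (w ∸ 1)

-- Stated for Fin n rather than Index w so that the size can be inferred.

swap : ∀ {n} → Fin n → Fin n
swap = opposite

rOf sOf : ∀ {n} → Fin n → ℕ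
rOf x = suc (toℕ x)
sOf x = rOf (swap x)

rOf+sOf≡w : ∀ w (x : Index w) → rOf x ℕ.+ sOf x ≡ w
rOf+sOf≡w (suc w) x = trans
  (ℕₚ.+-suc (suc (toℕ x)) (toℕ (opposite x)))
  (cong suc (trans (cong (suc (toℕ x) ℕ.+_) (opposite-prop x))
                   (ℕₚ.m+[n∸m]≡n (toℕ<n x))))

------------------------------------------------------------------------
-- The formal double zeta space

infixl 6 _+ᴰ_
infixr 7 _·_
infix  8 -ᴰ_
infix  4 _≈_

-- ℚ-linear combinations of the generators Z r s , P r s (indexed by the
-- pairs (r , s)) and Zʷ = Z_w, taken up to the relation _≈_ below.

data 𝒟 (w : ℕ) : Set where
  Z P  : Index w → 𝒟 w
  Zʷ   : 𝒟 w
  0ᴰ   : 𝒟 w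
  _+ᴰ_ : 𝒟 w → 𝒟 w → 𝒟 w
  _·_  : ℚ → 𝒟 w → 𝒟 w

-ᴰ_ : ∀ {w} → 𝒟 w → 𝒟 w
-ᴰ u = (- 1ℚ) · u

∑ᴰ : ∀ {w} {A : Set} → List A → (A → 𝒟 w) → 𝒟 w
∑ᴰ xs f = foldr _+ᴰ_ 0ᴰ (map f xs)

pairs : ∀ w → List (Index w)
pairs w = allFin (w ∸ 1)

-- The coefficient of Z r s in the relation for P i j.

shuffleCoeff : ∀ {n} → Fin n → Fin n → ℕ
shuffleCoeff ij rs =
  (rOf rs ∸ 1) C (rOf ij ∸ 1) ℕ.+ (rOf rs ∸ 1) C (sOf ij ∸ 1)

-- The least ℚ-linear congruence containing the two defining relations.

data _≈_ {w : ℕ} : 𝒟 w → 𝒟 w → Set where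
  stuffle : ∀ rs → Z rs +ᴰ Z (swap rs) ≈ P rs +ᴰ -ᴰ Zʷ
  shuffle : ∀ ij →
    ∑ᴰ (pairs w) (λ rs → fromℕ (shuffleCoeff ij rs) · Z rs) ≈ P ij

  ≈-refl  : ∀ {u} → u ≈ u
  ≈-sym   : ∀ {u v} → u ≈ v → v ≈ u
  ≈-trans : ∀ {t u v} → t ≈ u → u ≈ v → t ≈ v
  +-cong  : ∀ {t u v x} → t ≈ u → v ≈ x → t +ᴰ v ≈ u +ᴰ x
  ·-cong  : ∀ a {u v} → u ≈ v → a · u ≈ a · v

  +-assoc     : ∀ t u v → (t +ᴰ u) +ᴰ v ≈ t +ᴰ (u +ᴰ v)
  +-comm      : ∀ u v → u +ᴰ v ≈ v +ᴰ u
  +-identityˡ : ∀ u → 0ᴰ +ᴰ u ≈ u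
  ·-zeroˡ     : ∀ u → 0ℚ · u ≈ 0ᴰ
  ·-identityˡ : ∀ u → 1ℚ · u ≈ u
  ·-assoc     : ∀ a b u → (a * b) · u ≈ a · (b · u)
  ·-distribʳ  : ∀ u a b → (a + b) · u ≈ a · u +ᴰ b · u
  ·-distribˡ  : ∀ a u v → a · (u +ᴰ v) ≈ a · u +ᴰ a · v

𝒟-setoid : ℕ → Setoid 0ℓ 0ℓ
𝒟-setoid w = record
  { Carrier       = 𝒟 w
  ; _≈_           = _≈_
  ; isEquivalence = record { refl = ≈-refl ; sym = ≈-sym ; trans = ≈-trans }
  }

module _ {w : ℕ} where
  open ≈-Reasoning (𝒟-setoid w)

  +-identityʳ : (u : 𝒟 w) → u +ᴰ 0ᴰ ≈ u
  +-identityʳ u = ≈-trans (+-comm u 0ᴰ) (+-identityˡ u)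

  ·-zeroʳ : ∀ a → a · 0ᴰ {w} ≈ 0ᴰ
  ·-zeroʳ a = begin
    a · 0ᴰ           ≈⟨ ·-cong a (·-zeroˡ 0ᴰ) ⟨
    a · (0ℚ · 0ᴰ)    ≈⟨ ·-assoc a 0ℚ 0ᴰ ⟨
    (a * 0ℚ) · 0ᴰ    ≡⟨ cong (_· 0ᴰ) (ℚₚ.*-zeroʳ a) ⟩
    0ℚ · 0ᴰ          ≈⟨ ·-zeroˡ 0ᴰ ⟩
    0ᴰ               ∎

  +-inverseˡ : (u : 𝒟 w) → -ᴰ u +ᴰ u ≈ 0ᴰ
  +-inverseˡ u = begin
    (- 1ℚ) · u +ᴰ u         ≈⟨ +-cong ≈-refl (·-identityˡ u) ⟨
    (- 1ℚ) · u +ᴰ 1ℚ · u    ≈⟨ ·-distribʳ u (- 1ℚ) 1ℚ ⟨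
    0ℚ · u                  ≈⟨ ·-zeroˡ u ⟩
    0ᴰ                      ∎

  +-inverseʳ : (u : 𝒟 w) → u +ᴰ -ᴰ u ≈ 0ᴰ
  +-inverseʳ u = ≈-trans (+-comm u (-ᴰ u)) (+-inverseˡ u)

𝒟-module : ℕ → Module ℚₚ.+-*-commutativeRing 0ℓ 0ℓ
𝒟-module w = record
  { Carrierᴹ = 𝒟 w
  ; _≈ᴹ_     = _≈_
  ; _+ᴹ_     = _+ᴰ_
  ; _*ₗ_     = _·_
  ; _*ᵣ_     = λ u a → a · u
  ; 0ᴹ       = 0ᴰ
  ; -ᴹ_      = -ᴰ_
  ; isModule = IsModuleFromLeft.isModule {commutativeRing = ℚₚ.+-*-commutativeRing} record
    { isLeftModule = record
      { isLeftSemimodule = record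
        { +ᴹ-isCommutativeMonoid = record
          { isMonoid = record
            { isSemigroup = record
              { isMagma = record
                { isEquivalence = Setoid.isEquivalence (𝒟-setoid w)
                ; ∙-cong        = +-cong
                }
              ; assoc = +-assoc
              }
            ; identity = +-identityˡ , +-identityʳ
            }
          ; comm = +-comm
          }
        ; isPreleftSemimodule = record
          { *ₗ-cong      = λ { {a} refl u≈v → ·-cong a u≈v }
          ; *ₗ-zeroˡ     = ·-zeroˡ
          ; *ₗ-distribʳ  = ·-distribʳ
          ; *ₗ-identityˡ = ·-identityˡ
          ; *ₗ-assoc     = ·-assoc
          ; *ₗ-zeroʳ     = ·-zeroʳ
          ; *ₗ-distribˡ  = ·-distribˡ
          }
        }
      ; -ᴹ‿cong    = ·-cong (- 1ℚ)
      ; -ᴹ‿inverse = +-inverseˡ , +-inverseʳ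
      }
    }
  }

------------------------------------------------------------------------
-- Polynomials in X and Y

-- f i j is the coefficient of X^i Y^j. Finiteness of the support is not
-- imposed, so these are the power series ℚ[[X,Y]] ⊇ ℚ[X,Y]; everything
-- built below from X, Y and elements of V k is a polynomial.

Poly : Set
Poly = ℕ → ℕ → ℚ

infixl 6 _⊕_ _⊖_
infixl 7 _⊛_
infixr 7 _⊙_
infixr 8 _^ᴾ_
infix  8 ⊝_
infix  4 _≈ᴾ_

_≈ᴾ_ : Poly → Poly → Set
f ≈ᴾ g = ∀ i j → f i j ≡ g i j

𝟎 𝟏 X Y : Poly
𝟎 _ _ = 0ℚ

𝟏 0 0 = 1ℚ
𝟏 _ _ = 0ℚ

X 1 0 = 1ℚ
X _ _ = 0ℚ

Y 0 1 = 1ℚ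
Y _ _ = 0ℚ

_⊕_ _⊖_ _⊛_ : Poly → Poly → Poly
(f ⊕ g) i j = f i j + g i j
(f ⊖ g) i j = f i j + - g i j
(f ⊛ g) i j = sum {suc i} λ a → sum {suc j} λ b →
  f (toℕ a) (toℕ b) * g (i ∸ toℕ a) (j ∸ toℕ b)

⊝_ : Poly → Poly
(⊝ f) i j = - f i j

_⊙_ : ℚ → Poly → Poly
(a ⊙ f) i j = a * f i j

_^ᴾ_ : Poly → ℕ → Poly
f ^ᴾ zero  = 𝟏
f ^ᴾ suc n = f ⊛ f ^ᴾ n

∑ᴾ : ∀ {n} → (Fin n → Poly) → Poly
∑ᴾ f i j = sum λ x → f x i j

∂X : Poly → Poly
∂X f i j = fromℕ (suc i) * f (suc i) j

------------------------------------------------------------------------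
-- Period polynomials

-- p : V k stands for ∑ᵢ pᵢ X^i Y^(k-2-i), 0 ≤ i ≤ k - 2 (for k ≥ 2).

V : ℕ → Set
V k = Vector ℚ (suc (k ∸ 2))

infix 9 _⟨_,_⟩

_⟨_,_⟩ : ∀ {d} → Vector ℚ (suc d) → Poly → Poly → Poly
_⟨_,_⟩ {d} p A B = ∑ᴾ λ i → p i ⊙ (A ^ᴾ toℕ i ⊛ B ^ᴾ (d ∸ toℕ i))

record W (k : ℕ) (p : V k) : Set where
  field
    two-term   : p ⟨ X , Y ⟩ ⊕ p ⟨ ⊝ Y , X ⟩ ≈ᴾ 𝟎
    three-term : p ⟨ X , Y ⟩ ⊕ p ⟨ X ⊖ Y , X ⟩ ⊕ p ⟨ Y , Y ⊖ X ⟩ ≈ᴾ 𝟎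

W⁻ : ∀ k → Pred (V k) 0ℓ
W⁻ k p = p ∈ W k × p ⟨ X , Y ⟩ ≈ᴾ ⊝ p ⟨ Y , X ⟩

{-# OPTIONS --safe #-}
module Submission where

-- Put n = k - 2, N = k - 3 and x = r - 1, so that x runs from 0 to N and
-- swapping r and s is x ↦ N - x. Let p = ∑ uᵢ XⁱYⁿ⁻ⁱ and e(x) = c(x) - c(N - x).
--
-- With S(a) = ∑ uᵢ C(i,a), the coefficients of p(X+Y,Y), membership in W⁻ says
-- that u is antisymmetric, supported on even i, and that u(a) = S(a) - S(n - a).
-- Combined with C(N,x) c(x) = (x+1) S(x+1) this gives e = φ + Tφ, where
-- (Tf)(r) = ∑ (-1)ⁱ C(r,i) f(i) and C(N,i) φ(i) = -(i+1) u(N - i). As T is an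
-- involution, Te = e.
--
-- Since N is odd, the weights (-1)ⁱ e(i) / 4 are symmetric under i ↦ N - i.
-- Summing the double shuffle relations with these weights makes
-- ∑ ½ ((Te)(x) - (-1)ˣ e(x)) Z = ∑ ½ (1 - (-1)ˣ) e(x) Z a multiple of Zʷ, which
-- leaves exactly the even r; the end terms r = 2 and r = k - 2 vanish because
-- e(1) = e(N) = 0.

open import Defs
open import Algebra.Bundles using (CommutativeRing)
open import Algebra.Module.Bundles using (Module)
import Algebra.Properties.CommutativeMonoid.Sum as MonoidSum
import Algebra.Properties.Group as GroupProperties
open import Data.Fin.Base using (Fin; zero; suc; toℕ; opposite)
import Data.Fin.Permutation as Perm
import Data.Fin.Properties as Finₚ
import Data.Integer.Base as ℤ
import Data.Integer.Properties as ℤₚ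
open import Data.List.Base using ([]; _∷_; foldr; tabulate; allFin; filter)
open import Data.List.Properties using (map-tabulate)
open import Data.Nat.Base as ℕ using (ℕ; zero; suc; _≤_; _<_; z≤n; s≤s; _∸_; _!)
open import Data.Nat.Combinatorics
  using (_C_; nCk≡nC[n∸k]; k>n⇒nCk≡0; nCk+nC[k+1]≡[n+1]C[k+1]; nCk≡n!/k![n-k]!; k![n∸k]!∣n!)
open import Data.Nat.Divisibility using (_∣_; _∣?_; divides; ∣m∣n⇒∣m+n; ∣-refl; _∣0)
open import Data.Nat.DivMod using (m/n*n≡m)
open import Data.Nat.Properties using (_≤?_)
import Data.Nat.Properties as ℕₚ
import Data.Nat.Solver as ℕSolver
open import Data.Product.Base using (_,_; _×_; ∃-syntax; proj₁; proj₂)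
open import Data.Rational.Base using (ℚ; 0ℚ; 1ℚ; ½; _+_; _*_; -_; _-_; 1/_; ≢-nonZero)
import Data.Rational.Properties as ℚₚ
open import Data.Rational.Solver using (module +-*-Solver)
open import Data.Rational.Unnormalised.Base as ℚᵘ using (mkℚᵘ; *≡*)
import Data.Rational.Unnormalised.Properties as ℚᵘₚ
open import Data.Sum.Base using (inj₁; inj₂)
open import Function.Base using (_∘_)
open import Relation.Binary.PropositionalEquality
import Relation.Binary.Reasoning.Setoid as SetoidReasoning
open import Relation.Nullary.Decidable using (_×-dec_)
open import Relation.Nullary.Decidable.Core using (Dec; yes; no)
open import Relation.Nullary.Negation using (¬_; contradiction)
open import Relation.Unary using (_∈_; Pred; Decidable)

open import Algebra.Properties.CommutativeMonoid.Sum ℚₚ.+-0-commutativeMonoid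
  using (sum; sum-cong-≗; ∑-distrib-+; ∑-comm; sum-permute; sum-replicate-zero)
open import Algebra.Properties.Semiring.Exp
  (CommutativeRing.semiring ℚₚ.+-*-commutativeRing) using (_^_)
open import Algebra.Properties.Semiring.Sum
  (CommutativeRing.semiring ℚₚ.+-*-commutativeRing) using (*-distribˡ-sum)
open +-*-Solver using (solve; _:+_; _:*_; _:-_; :-_; _:=_; con)
private module ℕS = ℕSolver.+-*-Solver

-- Sums and binomial coefficients in ℚ

-- The binomial `(k ∸ 3) C (rOf rs ∸ 1)` in the definition of c is the bridge between polynomials
-- and shuffle coefficients. Attach to a sequence f the form F(X,Y) = ∑ C(N,i) f(i) XⁱYᴺ⁻ⁱ. Then Tf
-- belongs to F(-X, X+Y), a substitution of order two. The sequence φ belongs to F = ∂p/∂X, because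
-- p is antisymmetric. The relation between u and S reads p(X,Y) = p(X+Y,Y) - p(X+Y,X), and its
-- X-derivative is F(X+Y,Y) - F(X+Y,X) = F(X,Y) - F(X,X+Y), whose left side belongs to e. As p is
-- even in X, F is odd in X, so the right side is F(X,Y) + F(-X,X+Y), the form of φ + Tφ. The proof
-- carries this out on coefficients, starting from ∂p/∂Y.

fromℕ-+ : ∀ m n → fromℕ (m ℕ.+ n) ≡ fromℕ m + fromℕ n
fromℕ-+ m n = ℚₚ.toℚᵘ-injective (begin
  _
    ≈⟨ ℚₚ.toℚᵘ-fromℚᵘ (mkℚᵘ (ℤ.+ (m ℕ.+ n)) 0) ⟩
  mkℚᵘ (ℤ.+ (m ℕ.+ n)) 0
    ≈⟨ *≡* (cong (ℤ._* (ℤ.+ 1))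
         (cong₂ ℤ._+_ (sym (ℤₚ.*-identityʳ (ℤ.+ m))) (sym (ℤₚ.*-identityʳ (ℤ.+ n))))) ⟩
  mkℚᵘ (ℤ.+ m) 0 ℚᵘ.+ mkℚᵘ (ℤ.+ n) 0
    ≈⟨ ℚᵘₚ.+-cong (ℚₚ.toℚᵘ-fromℚᵘ (mkℚᵘ (ℤ.+ m) 0)) (ℚₚ.toℚᵘ-fromℚᵘ (mkℚᵘ (ℤ.+ n) 0)) ⟨
  _
    ≈⟨ ℚₚ.toℚᵘ-homo-+ (fromℕ m) (fromℕ n) ⟨
  _ ∎)
  where open import Relation.Binary.Reasoning.Setoid ℚᵘₚ.≃-setoid

fromℕ-suc : ∀ n → fromℕ (suc n) ≡ 1ℚ + fromℕ n
fromℕ-suc = fromℕ-+ 1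

fromℕ-* : ∀ m n → fromℕ (m ℕ.* n) ≡ fromℕ m * fromℕ n
fromℕ-* zero    n = sym (ℚₚ.*-zeroˡ (fromℕ n))
fromℕ-* (suc m) n = begin
  fromℕ (n ℕ.+ m ℕ.* n)          ≡⟨ fromℕ-+ n (m ℕ.* n) ⟩
  fromℕ n + fromℕ (m ℕ.* n)      ≡⟨ cong (fromℕ n +_) (fromℕ-* m n) ⟩
  fromℕ n + fromℕ m * fromℕ n    ≡⟨ solve 2 (λ x y → x :+ y :* x := (con 1ℚ :+ y) :* x) refl (fromℕ n) (fromℕ m) ⟩
  (1ℚ + fromℕ m) * fromℕ n       ≡⟨ cong (_* fromℕ n) (sym (fromℕ-suc m)) ⟩
  fromℕ (suc m) * fromℕ n        ∎
  where open ≡-Reasoning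

fromℕ-∸ : ∀ {m n} → m ≤ n → fromℕ (n ∸ m) ≡ fromℕ n - fromℕ m
fromℕ-∸ {m} {n} m≤n = begin
  fromℕ (n ∸ m)                          ≡⟨ solve 2 (λ x y → y := x :+ y :- x) refl (fromℕ m) _ ⟩
  fromℕ m + fromℕ (n ∸ m) - fromℕ m      ≡⟨ cong (_- fromℕ m) (sym (fromℕ-+ m (n ∸ m))) ⟩
  fromℕ (m ℕ.+ (n ∸ m)) - fromℕ m        ≡⟨ cong (λ t → fromℕ t - fromℕ m) (ℕₚ.m+[n∸m]≡n m≤n) ⟩
  fromℕ n - fromℕ m                      ∎
  where open ≡-Reasoning

fromℕ-injective : ∀ {m n} → fromℕ m ≡ fromℕ n → m ≡ n
fromℕ-injective {m} {n} eq with ℚₚ.fromℚᵘ-injective {mkℚᵘ (ℤ.+ m) 0} {mkℚᵘ (ℤ.+ n) 0} eq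
... | *≡* eq′ = ℕₚ.*-cancelʳ-≡ m n 1 (ℤₚ.+-injective (trans (ℤₚ.pos-* m 1) (trans eq′ (sym (ℤₚ.pos-* n 1)))))

-- Opaque, so that unification recovers f from ∑< n f.
opaque
  ∑< : ℕ → (ℕ → ℚ) → ℚ
  ∑< n f = sum {n} (f ∘ toℕ)

  ∑<-cong : ∀ n {f g} → (∀ {i} → i < n → f i ≡ g i) → ∑< n f ≡ ∑< n g
  ∑<-cong n f≗g = sum-cong-≗ {n} (λ i → f≗g (Finₚ.toℕ<n i))

  ∑<-suc : ∀ n f → ∑< (suc n) f ≡ f 0 + ∑< n (f ∘ suc)
  ∑<-suc n f = refl

  ∑<-zero : ∀ n → ∑< n (λ _ → 0ℚ) ≡ 0ℚ
  ∑<-zero = sum-replicate-zero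

  ∑<-+ : ∀ n f g → ∑< n (λ i → f i + g i) ≡ ∑< n f + ∑< n g
  ∑<-+ n f g = ∑-distrib-+ {n} (f ∘ toℕ) (g ∘ toℕ)

  ∑<-*ˡ : ∀ n a f → ∑< n (λ i → a * f i) ≡ a * ∑< n f
  ∑<-*ˡ n a f = sym (*-distribˡ-sum {n} a (f ∘ toℕ))

  ∑<-neg : ∀ n f → ∑< n (λ i → - f i) ≡ - ∑< n f
  ∑<-neg n f = begin
    ∑< n (λ i → - f i)          ≡⟨ ∑<-cong n (λ {i} _ → solve 1 (λ x → :- x := con (- 1ℚ) :* x) refl (f i)) ⟩
    ∑< n (λ i → - 1ℚ * f i)     ≡⟨ ∑<-*ˡ n (- 1ℚ) f ⟩
    - 1ℚ * ∑< n f               ≡⟨ solve 1 (λ x → con (- 1ℚ) :* x := :- x) refl (∑< n f) ⟩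
    - ∑< n f                    ∎
    where open ≡-Reasoning

  ∑<-reverse : ∀ n f → ∑< (suc n) f ≡ ∑< (suc n) (λ i → f (n ∸ i))
  ∑<-reverse n f = trans (sum-permute (f ∘ toℕ) (Perm.reverse {suc n}))
    (sum-cong-≗ {suc n} (λ i → cong f (Finₚ.opposite-prop i)))

∑<-single : ∀ n {f k} → k < n → (∀ {i} → i < n → i ≢ k → f i ≡ 0ℚ) → ∑< n f ≡ f k
∑<-single (suc n) {f} {zero} _ f≡0 = trans (∑<-suc n f) (trans
  (cong (f 0 +_) (trans (∑<-cong n (λ i<n → f≡0 (s≤s i<n) λ ())) (∑<-zero n)))
  (ℚₚ.+-identityʳ (f 0)))
∑<-single (suc n) {f} {suc k} (s≤s k<n) f≡0 = trans (∑<-suc n f) (trans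
  (cong₂ _+_ (f≡0 (s≤s z≤n) λ ())
             (∑<-single n {f ∘ suc} k<n (λ i<n i≢k → f≡0 (s≤s i<n) (i≢k ∘ ℕₚ.suc-injective))))
  (ℚₚ.+-identityˡ (f (suc k))))

infix 8 _choose_

opaque
  -- Opaque, so that binomials stay atoms instead of unfolding to normalised fractions.
  _choose_ : ℕ → ℕ → ℚ
  n choose k = fromℕ (n C k)

  choose-fromℕ : ∀ n k → n choose k ≡ fromℕ (n C k)
  choose-fromℕ n k = refl

  choose-zero : ∀ n → n choose 0 ≡ 1ℚ
  choose-zero n = refl

  0choose : ∀ k → 0 choose suc k ≡ 0ℚ
  0choose k = refl

  choose-> : ∀ {n k} → n < k → n choose k ≡ 0ℚ
  choose-> n<k = cong fromℕ (k>n⇒nCk≡0 n<k)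

  pascal : ∀ n k → suc n choose suc k ≡ n choose k + n choose suc k
  pascal n k = trans (cong fromℕ (sym (nCk+nC[k+1]≡[n+1]C[k+1] n k))) (fromℕ-+ (n C k) (n C suc k))

-- Pascal's rule and induction on n. The difference is taken in ℚ, so n ≤ k is covered too: both
-- sides are then 0. It is used to trade S(x+1) for a sum over the binomials in S(x).
choose-absorb : ∀ n k → fromℕ (suc k) * n choose suc k ≡ (fromℕ n - fromℕ k) * n choose k
choose-absorb zero zero = trans (cong (1ℚ *_) (0choose 0)) (cong ((0ℚ - 0ℚ) *_) (sym (choose-zero 0)))
choose-absorb zero (suc k) = trans (trans (cong (fromℕ (2 ℕ.+ k) *_) (0choose (suc k))) (ℚₚ.*-zeroʳ (fromℕ (2 ℕ.+ k))))
  (sym (trans (cong ((0ℚ - fromℕ (suc k)) *_) (0choose k)) (ℚₚ.*-zeroʳ (0ℚ - fromℕ (suc k)))))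
choose-absorb (suc n) zero = begin
  1ℚ * suc n choose 1                  ≡⟨ ℚₚ.*-identityˡ (suc n choose 1) ⟩
  suc n choose 1                       ≡⟨ pascal n 0 ⟩
  n choose 0 + n choose 1              ≡⟨ cong (n choose 0 +_) (trans (sym (ℚₚ.*-identityˡ (n choose 1))) (choose-absorb n 0)) ⟩
  n choose 0 + (fromℕ n - 0ℚ) * n choose 0
    ≡⟨ solve 2 (λ x y → y :+ (x :- con 0ℚ) :* y := (con 1ℚ :+ x :- con 0ℚ) :* y) refl (fromℕ n) (n choose 0) ⟩
  (1ℚ + fromℕ n - 0ℚ) * n choose 0     ≡⟨ cong (λ t → (t - 0ℚ) * n choose 0) (fromℕ-suc n) ⟨
  (fromℕ (suc n) - 0ℚ) * n choose 0    ≡⟨ cong ((fromℕ (suc n) - 0ℚ) *_) (trans (choose-zero n) (sym (choose-zero (suc n)))) ⟩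
  (fromℕ (suc n) - 0ℚ) * suc n choose 0 ∎
  where open ≡-Reasoning
choose-absorb (suc n) (suc k) = begin
  fromℕ (2 ℕ.+ k) * suc n choose (2 ℕ.+ k)
    ≡⟨ cong₂ _*_ (fromℕ-suc (suc k)) (pascal n (suc k)) ⟩
  (1ℚ + fromℕ (suc k)) * (B + C′)
    ≡⟨ solve 3 (λ x b c → (con 1ℚ :+ x) :* (b :+ c) := (con 1ℚ :+ x) :* b :+ (con 1ℚ :+ x) :* c) refl (fromℕ (suc k)) B C′ ⟩
  (1ℚ + fromℕ (suc k)) * B + (1ℚ + fromℕ (suc k)) * C′
    ≡⟨ cong (λ t → (1ℚ + fromℕ (suc k)) * B + t * C′) (fromℕ-suc (suc k)) ⟨
  (1ℚ + fromℕ (suc k)) * B + fromℕ (2 ℕ.+ k) * C′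
    ≡⟨ cong ((1ℚ + fromℕ (suc k)) * B +_) (choose-absorb n (suc k)) ⟩
  (1ℚ + fromℕ (suc k)) * B + (fromℕ n - fromℕ (suc k)) * B
    ≡⟨ cong (λ t → (1ℚ + t) * B + (fromℕ n - t) * B) (fromℕ-suc k) ⟩
  (1ℚ + (1ℚ + fromℕ k)) * B + (fromℕ n - (1ℚ + fromℕ k)) * B
    ≡⟨ solve 3 (λ n k b → (con 1ℚ :+ (con 1ℚ :+ k)) :* b :+ (n :- (con 1ℚ :+ k)) :* b
                 := (con 1ℚ :+ k) :* b :+ (n :- k) :* b) refl (fromℕ n) (fromℕ k) B ⟩
  (1ℚ + fromℕ k) * B + (fromℕ n - fromℕ k) * B
    ≡⟨ cong (λ t → t * B + (fromℕ n - fromℕ k) * B) (fromℕ-suc k) ⟨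
  fromℕ (suc k) * B + (fromℕ n - fromℕ k) * B
    ≡⟨ cong (_+ (fromℕ n - fromℕ k) * B) (choose-absorb n k) ⟩
  (fromℕ n - fromℕ k) * A + (fromℕ n - fromℕ k) * B
    ≡⟨ solve 4 (λ n k a b → (n :- k) :* a :+ (n :- k) :* b
                 := (con 1ℚ :+ n :- (con 1ℚ :+ k)) :* (a :+ b)) refl (fromℕ n) (fromℕ k) A B ⟩
  (1ℚ + fromℕ n - (1ℚ + fromℕ k)) * (A + B)
    ≡⟨ cong₂ _*_ (cong₂ _-_ (fromℕ-suc n) (fromℕ-suc k)) (pascal n k) ⟨
  (fromℕ (suc n) - fromℕ (suc k)) * suc n choose suc k ∎
  where
  open ≡-Reasoning
  A = n choose k
  B = n choose suc k
  C′ = n choose suc (suc k)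

-- Products of binomial coefficients via factorials

C*k![n∸k]! : ∀ {n k} → k ≤ n → (n C k) ℕ.* (k ! ℕ.* (n ∸ k) !) ≡ n !
C*k![n∸k]! {n} {k} k≤n = trans (cong (ℕ._* (k ! ℕ.* (n ∸ k) !)) (nCk≡n!/k![n-k]! k≤n))
  (m/n*n≡m {{ℕₚ._!*_!≢0 k (n ∸ k)}} (k![n∸k]!∣n! k≤n))

private
  -- Both sides are the multinomial coefficient n! / (i! u! v!), so they agree after multiplication
  -- by i! u! v!. Writing n = i + u + v keeps truncated subtraction out of the computation.
  trinomial′ : ∀ i u v → let n = i ℕ.+ u ℕ.+ v in
    (n C (i ℕ.+ u)) ℕ.* ((i ℕ.+ u) C i) ≡ (n C i) ℕ.* ((u ℕ.+ v) C v)
  trinomial′ i u v = ℕₚ.*-cancelʳ-≡ _ _ (i ! ℕ.* (u ! ℕ.* v !)) {{nz}} (trans lhs (sym rhs))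
    where
    open ≡-Reasoning
    n = i ℕ.+ u ℕ.+ v
    nz = ℕₚ.m*n≢0 (i !) (u ! ℕ.* v !) {{ℕₚ._!≢0 i}} {{ℕₚ._!*_!≢0 u v}}
    f₁ : (n C (i ℕ.+ u)) ℕ.* ((i ℕ.+ u) ! ℕ.* v !) ≡ n !
    f₁ = subst (λ t → (n C (i ℕ.+ u)) ℕ.* ((i ℕ.+ u) ! ℕ.* t !) ≡ n !) (ℕₚ.m+n∸m≡n (i ℕ.+ u) v)
           (C*k![n∸k]! (ℕₚ.m≤m+n (i ℕ.+ u) v))
    f₂ : ((i ℕ.+ u) C i) ℕ.* (i ! ℕ.* u !) ≡ (i ℕ.+ u) !
    f₂ = subst (λ t → ((i ℕ.+ u) C i) ℕ.* (i ! ℕ.* t !) ≡ (i ℕ.+ u) !) (ℕₚ.m+n∸m≡n i u)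
           (C*k![n∸k]! (ℕₚ.m≤m+n i u))
    f₃ : (n C i) ℕ.* (i ! ℕ.* (u ℕ.+ v) !) ≡ n !
    f₃ = subst (λ t → (n C i) ℕ.* (i ! ℕ.* t !) ≡ n !)
           (trans (cong (_∸ i) (ℕₚ.+-assoc i u v)) (ℕₚ.m+n∸m≡n i (u ℕ.+ v)))
           (C*k![n∸k]! (ℕₚ.≤-trans (ℕₚ.m≤m+n i u) (ℕₚ.m≤m+n (i ℕ.+ u) v)))
    f₄ : ((u ℕ.+ v) C v) ℕ.* (v ! ℕ.* u !) ≡ (u ℕ.+ v) !
    f₄ = subst (λ t → ((u ℕ.+ v) C v) ℕ.* (v ! ℕ.* t !) ≡ (u ℕ.+ v) !) (ℕₚ.m+n∸n≡m u v)
           (C*k![n∸k]! (ℕₚ.m≤n+m v u))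
    lhs : (n C (i ℕ.+ u)) ℕ.* ((i ℕ.+ u) C i) ℕ.* (i ! ℕ.* (u ! ℕ.* v !)) ≡ n !
    lhs = trans (ℕS.solve 5 (λ a b x y z → a ℕS.:* b ℕS.:* (x ℕS.:* (y ℕS.:* z)) ℕS.:= a ℕS.:* (b ℕS.:* (x ℕS.:* y) ℕS.:* z))
                   refl (n C (i ℕ.+ u)) ((i ℕ.+ u) C i) (i !) (u !) (v !))
          (trans (cong (λ t → (n C (i ℕ.+ u)) ℕ.* (t ℕ.* v !)) f₂) f₁)
    rhs : (n C i) ℕ.* ((u ℕ.+ v) C v) ℕ.* (i ! ℕ.* (u ! ℕ.* v !)) ≡ n !
    rhs = trans (ℕS.solve 5 (λ a b x y z → a ℕS.:* b ℕS.:* (x ℕS.:* (y ℕS.:* z)) ℕS.:= a ℕS.:* (x ℕS.:* (b ℕS.:* (z ℕS.:* y))))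
                   refl (n C i) ((u ℕ.+ v) C v) (i !) (u !) (v !))
          (trans (cong (λ t → (n C i) ℕ.* (i ! ℕ.* t)) f₄) f₃)

-- Reduces to `trinomial′` when i ≤ k, and for k < i both sides vanish. It turns the reflected
-- binomials of a reversed sum into row k of Pascal's triangle, which is the row that the transform
-- uses.
choose-trinomial : ∀ {n k i} → k ≤ n → i ≤ n →
  n choose i * (n ∸ i) choose (n ∸ k) ≡ n choose k * k choose i
choose-trinomial {n} {k} {i} k≤n i≤n with ℕₚ.≤-<-connex i k
... | inj₂ k<i = trans
  (cong (n choose i *_) (choose-> (ℕₚ.∸-monoʳ-< k<i i≤n)))
  (trans (ℚₚ.*-zeroʳ (n choose i)) (sym (trans (cong (n choose k *_) (choose-> k<i)) (ℚₚ.*-zeroʳ (n choose k)))))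
... | inj₁ i≤k with ℕₚ.m≤n⇒∃[o]m+o≡n i≤k
... | u , refl with ℕₚ.m≤n⇒∃[o]m+o≡n k≤n
... | v , refl = begin
  N choose i * (N ∸ i) choose (N ∸ (i ℕ.+ u))
    ≡⟨ cong₂ (λ s t → N choose i * s choose t)
         (trans (cong (_∸ i) (ℕₚ.+-assoc i u v)) (ℕₚ.m+n∸m≡n i (u ℕ.+ v)))
         (ℕₚ.m+n∸m≡n (i ℕ.+ u) v) ⟩
  N choose i * (u ℕ.+ v) choose v         ≡⟨ cong₂ _*_ (choose-fromℕ N i) (choose-fromℕ (u ℕ.+ v) v) ⟩
  fromℕ (N C i) * fromℕ ((u ℕ.+ v) C v)   ≡⟨ fromℕ-* (N C i) ((u ℕ.+ v) C v) ⟨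
  fromℕ ((N C i) ℕ.* ((u ℕ.+ v) C v))       ≡⟨ cong fromℕ (trinomial′ i u v) ⟨
  fromℕ ((N C (i ℕ.+ u)) ℕ.* ((i ℕ.+ u) C i)) ≡⟨ fromℕ-* (N C (i ℕ.+ u)) ((i ℕ.+ u) C i) ⟩
  fromℕ (N C (i ℕ.+ u)) * fromℕ ((i ℕ.+ u) C i) ≡⟨ cong₂ _*_ (choose-fromℕ N (i ℕ.+ u)) (choose-fromℕ (i ℕ.+ u) i) ⟨
  N choose (i ℕ.+ u) * (i ℕ.+ u) choose i ∎
  where
  open ≡-Reasoning
  N = i ℕ.+ u ℕ.+ v

choose≢0 : ∀ {n k} → k ≤ n → n choose k ≢ 0ℚ
choose≢0 {n} {k} k≤n eq = contradiction
  (trans (sym (C*k![n∸k]! k≤n)) (cong (ℕ._* (k ! ℕ.* (n ∸ k) !)) (fromℕ-injective {n C k} {0} (trans (sym (choose-fromℕ n k)) eq))))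
  (ℕ.≢-nonZero⁻¹ (n !) {{ℕₚ._!≢0 n}})

-- The signed binomial transform

module _ where
  open ≡-Reasoning

  sign : ℕ → ℚ
  sign zero    = 1ℚ
  sign (suc n) = - sign n

  sign-+ : ∀ m n → sign (m ℕ.+ n) ≡ sign m * sign n
  sign-+ zero    n = sym (ℚₚ.*-identityˡ (sign n))
  sign-+ (suc m) n = trans (cong -_ (sign-+ m n)) (ℚₚ.neg-distribˡ-* (sign m) (sign n))

  sign-square : ∀ n → sign n * sign n ≡ 1ℚ
  sign-square zero    = refl
  sign-square (suc n) = trans
    (solve 1 (λ s → (:- s) :* (:- s) := s :* s) refl (sign n)) (sign-square n)

  sign-∸ : ∀ {m n} → m ≤ n → sign (n ∸ m) ≡ sign n * sign m
  sign-∸ {m} {n} m≤n = begin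
    sign (n ∸ m)                       ≡⟨ ℚₚ.*-identityʳ (sign (n ∸ m)) ⟨
    sign (n ∸ m) * 1ℚ                  ≡⟨ cong (sign (n ∸ m) *_) (sign-square m) ⟨
    sign (n ∸ m) * (sign m * sign m)   ≡⟨ ℚₚ.*-assoc (sign (n ∸ m)) (sign m) (sign m) ⟨
    sign (n ∸ m) * sign m * sign m     ≡⟨ cong (_* sign m) (sign-+ (n ∸ m) m) ⟨
    sign (n ∸ m ℕ.+ m) * sign m        ≡⟨ cong (λ t → sign t * sign m) (ℕₚ.m∸n+n≡m m≤n) ⟩
    sign n * sign m                    ∎

  x≡-x⇒x≡0 : ∀ {x} → x ≡ - x → x ≡ 0ℚ
  x≡-x⇒x≡0 {x} x≡-x = begin
    x               ≡⟨ solve 1 (λ x → x := con ½ :* (x :+ x)) refl x ⟩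
    ½ * (x + x)     ≡⟨ cong (λ t → ½ * (x + t)) x≡-x ⟩
    ½ * (x + - x)   ≡⟨ solve 1 (λ x → con ½ :* (x :+ :- x) := con 0ℚ) refl x ⟩
    0ℚ              ∎

  *-cancelˡ-≢0 : ∀ {a x y} → a ≢ 0ℚ → a * x ≡ a * y → x ≡ y
  *-cancelˡ-≢0 {a} {x} {y} a≢0 eq = begin
    x               ≡⟨ unit x ⟨
    1/ a * (a * x)  ≡⟨ cong (1/ a *_) eq ⟩
    1/ a * (a * y)  ≡⟨ unit y ⟩
    y               ∎
    where
    instance _ = ≢-nonZero a≢0
    unit : ∀ z → 1/ a * (a * z) ≡ z
    unit z = trans (sym (ℚₚ.*-assoc (1/ a) a z))
      (trans (cong (_* z) (ℚₚ.*-inverseˡ a)) (ℚₚ.*-identityˡ z))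

  infixl 7 _÷₀_

  -- Total division with value 0 at denominator 0, so that φ can be defined on all of ℕ although
  -- `N choose i` vanishes for i > N.
  _÷₀_ : ℚ → ℚ → ℚ
  a ÷₀ b with b ℚₚ.≟ 0ℚ
  ... | yes _   = 0ℚ
  ... | no  b≢0 = (1/ b) {{≢-nonZero b≢0}} * a

  *-÷₀ : ∀ a {b} → b ≢ 0ℚ → b * (a ÷₀ b) ≡ a
  *-÷₀ a {b} b≢0 with b ℚₚ.≟ 0ℚ
  ... | yes b≡0  = contradiction b≡0 b≢0
  ... | no  b≢0′ = trans (sym (ℚₚ.*-assoc b (1/ b) a))
      (trans (cong (_* a) (ℚₚ.*-inverseʳ b)) (ℚₚ.*-identityˡ a))
    where instance _ = ≢-nonZero b≢0′

  -- ∑ᵢ (-1)ⁱ C(r,i) f(i), see `transform-sum`; as an iterated difference it is visibly involutive.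
  transform : (ℕ → ℚ) → ℕ → ℚ
  transform f zero    = f 0
  transform f (suc r) = transform (λ i → f i - f (suc i)) r

  transform-cong : ∀ {f g} → (∀ i → f i ≡ g i) → ∀ r → transform f r ≡ transform g r
  transform-cong f≗g zero    = f≗g 0
  transform-cong f≗g (suc r) = transform-cong (λ i → cong₂ _-_ (f≗g i) (f≗g (suc i))) r

  transform-+ : ∀ f g r → transform (λ i → f i + g i) r ≡ transform f r + transform g r
  transform-+ f g zero    = refl
  transform-+ f g (suc r) = trans
    (transform-cong (λ i → solve 4 (λ a b c d → a :+ b :- (c :+ d) := a :- c :+ (b :- d)) refl
                             (f i) (g i) (f (suc i)) (g (suc i))) r)
    (transform-+ (λ i → f i - f (suc i)) (λ i → g i - g (suc i)) r)

  transform-∸ : ∀ f g r → transform (λ i → f i - g i) r ≡ transform f r - transform g r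
  transform-∸ f g zero    = refl
  transform-∸ f g (suc r) = trans
    (transform-cong (λ i → solve 4 (λ a b c d → a :- b :- (c :- d) := a :- c :- (b :- d)) refl
                             (f i) (g i) (f (suc i)) (g (suc i))) r)
    (transform-∸ (λ i → f i - f (suc i)) (λ i → g i - g (suc i)) r)

  -- T turns the shift into a difference: (Tf)(i) - (Tf)(i+1) = T(f ∘ suc)(i). Hence T(Tf) at r + 1
  -- is T(T(f ∘ suc)) at r, and induction applies.
  transform-involutive : ∀ f r → transform (transform f) r ≡ f r
  transform-involutive f zero    = refl
  transform-involutive f (suc r) = trans
    (transform-cong (λ i → trans (cong (λ t → transform f i - t) (transform-∸ f (f ∘ suc) i))
       (solve 2 (λ a b → a :- (a :- b) := b) refl (transform f i) (transform (f ∘ suc) i))) r)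
    (transform-involutive (f ∘ suc) r)

  -- Any range beyond r is allowed because C(r,i) = 0 for i > r; thus all r ≤ N can share one range.
  transform-sum : ∀ f {r m} → r ≤ m →
    transform f r ≡ ∑< (suc m) (λ i → r choose i * (sign i * f i))
  transform-sum f {zero} {m} z≤n = sym (begin
    ∑< (suc m) (λ i → 0 choose i * (sign i * f i))
      ≡⟨ ∑<-suc m (λ i → 0 choose i * (sign i * f i)) ⟩
    0 choose 0 * (1ℚ * f 0) + ∑< m (λ i → 0 choose suc i * (- sign i * f (suc i)))
      ≡⟨ cong₂ (λ s t → s * (1ℚ * f 0) + t) (choose-zero 0)
           (trans (∑<-cong m {g = λ _ → 0ℚ} (λ {i} _ →
               trans (cong (_* (- sign i * f (suc i))) (0choose i)) (ℚₚ.*-zeroˡ (- sign i * f (suc i)))))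
             (∑<-zero m)) ⟩
    1ℚ * (1ℚ * f 0) + 0ℚ
      ≡⟨ solve 1 (λ x → con 1ℚ :* (con 1ℚ :* x) :+ con 0ℚ := x) refl (f 0) ⟩
    f 0 ∎)
  transform-sum f {suc r} {suc m} (s≤s r≤m) = begin
    transform (λ i → f i - f (suc i)) r
      ≡⟨ transform-∸ f (f ∘ suc) r ⟩
    transform f r - transform (f ∘ suc) r
      -- The first sum is taken one term longer: once its term i = 0 is split off, both sums have
      -- the same range and Pascal's rule merges them.
      ≡⟨ cong₂ _-_ (transform-sum f (ℕₚ.m≤n⇒m≤1+n r≤m)) (transform-sum (f ∘ suc) r≤m) ⟩
    ∑< (2 ℕ.+ m) (λ i → r choose i * (sign i * f i)) - ∑< (suc m) b
      ≡⟨ cong (_- ∑< (suc m) b) (∑<-suc (suc m) (λ i → r choose i * (sign i * f i))) ⟩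
    r choose 0 * (1ℚ * f 0) + ∑< (suc m) a - ∑< (suc m) b
      ≡⟨ solve 3 (λ x y z → x :+ y :- z := x :+ (y :+ (:- z))) refl (r choose 0 * (1ℚ * f 0)) (∑< (suc m) a) (∑< (suc m) b) ⟩
    r choose 0 * (1ℚ * f 0) + (∑< (suc m) a + - ∑< (suc m) b)
      ≡⟨ cong (λ t → t * (1ℚ * f 0) + (∑< (suc m) a + - ∑< (suc m) b))
           (trans (choose-zero r) (sym (choose-zero (suc r)))) ⟩
    suc r choose 0 * (1ℚ * f 0) + (∑< (suc m) a + - ∑< (suc m) b)
      ≡⟨ cong (suc r choose 0 * (1ℚ * f 0) +_) (sym tail) ⟩
    suc r choose 0 * (1ℚ * f 0) + ∑< (suc m) (λ i → suc r choose suc i * (- sign i * f (suc i)))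
      ≡⟨ ∑<-suc (suc m) (λ i → suc r choose i * (sign i * f i)) ⟨
    ∑< (2 ℕ.+ m) (λ i → suc r choose i * (sign i * f i)) ∎
    where
    a b : ℕ → ℚ
    a i = r choose suc i * (- sign i * f (suc i))
    b i = r choose i * (sign i * f (suc i))
    tail : ∑< (suc m) (λ i → suc r choose suc i * (- sign i * f (suc i)))
           ≡ ∑< (suc m) a + - ∑< (suc m) b
    tail = begin
      ∑< (suc m) (λ i → suc r choose suc i * (- sign i * f (suc i)))
        ≡⟨ ∑<-cong (suc m) (λ {i} _ → trans (cong (_* (- sign i * f (suc i))) (pascal r i))
             (solve 4 (λ x y s z → (x :+ y) :* (:- s :* z) := y :* (:- s :* z) :+ :- (x :* (s :* z)))
                refl (r choose i) (r choose suc i) (sign i) (f (suc i)))) ⟩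
      ∑< (suc m) (λ i → a i + - b i)
        ≡⟨ ∑<-+ (suc m) a (λ i → - b i) ⟩
      ∑< (suc m) a + ∑< (suc m) (λ i → - b i)
        ≡⟨ cong (∑< (suc m) a +_) (∑<-neg (suc m) b) ⟩
      ∑< (suc m) a + - ∑< (suc m) b ∎

  choose-sym : ∀ {n k} → k ≤ n → n choose (n ∸ k) ≡ n choose k
  choose-sym {n} {k} k≤n = trans (choose-fromℕ n (n ∸ k))
    (trans (cong fromℕ (sym (nCk≡nC[n∸k] k≤n))) (sym (choose-fromℕ n k)))

  -- Self-duality of the antisymmetrised coefficients

  binomialSum : ℕ → (ℕ → ℚ) → ℕ → ℚ
  binomialSum n u a = ∑< (suc n) (λ i → u i * i choose a)

  antisymmetrize : ℕ → (ℕ → ℚ) → ℕ → ℚ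
  antisymmetrize N c x = c x - c (N ∸ x)

  -- The interface between the two halves of the proof: beyond these properties and the parity of N,
  -- the computation in the double zeta space knows nothing about p. `self-dual` is Te = e in the
  -- explicit form of `transform-sum`.
  record SelfDual (N : ℕ) (e : ℕ → ℚ) : Set where
    field
      antisym   : ∀ {x} → x ≤ N → e (N ∸ x) ≡ - e x
      self-dual : ∀ {r} → r ≤ N → ∑< (suc N) (λ i → r choose i * (sign i * e i)) ≡ e r
      e[0]≡0    : e 0 ≡ 0ℚ
      e[1]≡0    : 1 ≤ N → e 1 ≡ 0ℚ

    e[N]≡0 : e N ≡ 0ℚ
    e[N]≡0 = trans (antisym z≤n) (cong -_ e[0]≡0)

  module Coefficients
    (N : ℕ) (N-odd : sign N ≡ - 1ℚ) (u : ℕ → ℚ)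
    (u-even : ∀ {a} → a ≤ suc N → sign a * u a ≡ u a)
    (u-period : ∀ {a} → a ≤ suc N →
      u a ≡ binomialSum (suc N) u a - binomialSum (suc N) u (suc N ∸ a))
    (c : ℕ → ℚ)
    (c-def : ∀ {x} → x ≤ N →
      N choose x * c x ≡ fromℕ (suc x) * binomialSum (suc N) u (suc x))
    where

    private
      n = suc N
      S = binomialSum n u

    private
      e : ℕ → ℚ
      e = antisymmetrize N c

      -- The coefficient of XⁱYᴺ⁻ⁱ in ∂p/∂Y.
      q : ℕ → ℚ
      q i = (fromℕ n - fromℕ i) * u i

      -- As u is antisymmetric, - q(N - i) = - (i+1) u(N - i) = (i+1) u(i+1), a coefficient of
      -- ∂p/∂X.
      φ : ℕ → ℚ
      φ i = (- q (N ∸ i)) ÷₀ (N choose i)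

      e-antisym : ∀ {x} → x ≤ N → e (N ∸ x) ≡ - e x
      e-antisym {x} x≤N = trans (cong (λ t → c (N ∸ x) - c t) (ℕₚ.m∸[m∸n]≡n x≤N))
        (solve 2 (λ a b → a :- b := :- (b :- a)) refl (c (N ∸ x)) (c x))

      -- On the right stand the coefficients of ∂p/∂Y at (X,Y) minus those at (X+Y,Y). The period
      -- relation removes S(n - x), absorption removes S(x+1), and the factors n - x and i - x
      -- combine to n - i.
      choose*e : ∀ {x} → x ≤ N →
        N choose x * e x ≡ q x - ∑< (suc n) (λ i → i choose x * q i)
      choose*e {x} x≤N = begin
        N choose x * e x
          ≡⟨ solve 3 (λ b c d → b :* (c :- d) := b :* c :- b :* d) refl (N choose x) (c x) (c (N ∸ x)) ⟩
        N choose x * c x - N choose x * c (N ∸ x)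
          ≡⟨ cong₂ _-_ (c-def x≤N) reflected ⟩
        fromℕ (suc x) * S (suc x) - d * (S x - u x)
          ≡⟨ cong (_- d * (S x - u x)) (sym (∑<-*ˡ (suc n) (fromℕ (suc x)) (λ i → u i * i choose suc x))) ⟩
        ∑< (suc n) (λ i → fromℕ (suc x) * (u i * i choose suc x)) - d * (S x - u x)
          ≡⟨ solve 4 (λ a d s p → a :- d :* (s :- p) := d :* p :- (:- a :+ d :* s)) refl
               (∑< (suc n) (λ i → fromℕ (suc x) * (u i * i choose suc x))) d (S x) (u x) ⟩
        q x - (- ∑< (suc n) (λ i → fromℕ (suc x) * (u i * i choose suc x)) + d * S x)
          ≡⟨ cong₂ (λ s t → q x - (s + t))
               (∑<-neg (suc n) (λ i → fromℕ (suc x) * (u i * i choose suc x)))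
               (∑<-*ˡ (suc n) d (λ i → u i * i choose x)) ⟨
        q x - (∑< (suc n) (λ i → - (fromℕ (suc x) * (u i * i choose suc x)))
               + ∑< (suc n) (λ i → d * (u i * i choose x)))
          ≡⟨ cong (λ t → q x - t) (∑<-+ (suc n) (λ i → - (fromℕ (suc x) * (u i * i choose suc x)))
                                   (λ i → d * (u i * i choose x))) ⟨
        q x - ∑< (suc n) (λ i → - (fromℕ (suc x) * (u i * i choose suc x)) + d * (u i * i choose x))
          ≡⟨ cong (λ t → q x - t) (∑<-cong (suc n) (λ {i} _ → term i)) ⟩
        q x - ∑< (suc n) (λ i → i choose x * q i) ∎
        where
        d = fromℕ n - fromℕ x
        x≤n = ℕₚ.m≤n⇒m≤1+n x≤N
        reflected : N choose x * c (N ∸ x) ≡ d * (S x - u x)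
        reflected = begin
          N choose x * c (N ∸ x)                     ≡⟨ cong (_* c (N ∸ x)) (choose-sym x≤N) ⟨
          N choose (N ∸ x) * c (N ∸ x)               ≡⟨ c-def (ℕₚ.m∸n≤m N x) ⟩
          fromℕ (suc (N ∸ x)) * S (suc (N ∸ x))      ≡⟨ cong (λ t → fromℕ t * S t) (sym (ℕₚ.+-∸-assoc 1 x≤N)) ⟩
          -- The next steps use the period relation in the form S(n - x) = S(x) - u(x).
          fromℕ (n ∸ x) * S (n ∸ x)                  ≡⟨ cong (_* S (n ∸ x)) (fromℕ-∸ x≤n) ⟩
          d * S (n ∸ x)                              ≡⟨ cong (d *_) (solve 2 (λ s t → t := s :- (s :- t)) refl (S x) (S (n ∸ x))) ⟩
          d * (S x - (S x - S (n ∸ x)))              ≡⟨ cong (λ t → d * (S x - t)) (u-period x≤n) ⟨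
          d * (S x - u x)                            ∎
        term : ∀ i → - (fromℕ (suc x) * (u i * i choose suc x)) + d * (u i * i choose x) ≡ i choose x * q i
        term i = begin
          - (fromℕ (suc x) * (u i * i choose suc x)) + d * (u i * i choose x)
            ≡⟨ solve 5 (λ y p b d b′ → :- (y :* (p :* b)) :+ d :* (p :* b′) := :- (p :* (y :* b)) :+ d :* (p :* b′))
                 refl (fromℕ (suc x)) (u i) (i choose suc x) d (i choose x) ⟩
          - (u i * (fromℕ (suc x) * i choose suc x)) + d * (u i * i choose x)
            ≡⟨ cong (λ t → - (u i * t) + d * (u i * i choose x)) (choose-absorb i x) ⟩
          - (u i * ((fromℕ i - fromℕ x) * i choose x)) + d * (u i * i choose x)
            ≡⟨ solve 5 (λ n i x p b → :- (p :* ((i :- x) :* b)) :+ (n :- x) :* (p :* b) := b :* ((n :- i) :* p))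
                 refl (fromℕ n) (fromℕ i) (fromℕ x) (u i) (i choose x) ⟩
          i choose x * q i ∎

      choose*φ : ∀ {i} → i ≤ N → N choose i * φ i ≡ - q (N ∸ i)
      choose*φ {i} i≤N = *-÷₀ (- q (N ∸ i)) (choose≢0 i≤N)

      q-even : ∀ {i} → i ≤ n → sign i * q i ≡ q i
      q-even {i} i≤n = trans
        (solve 3 (λ s d p → s :* (d :* p) := d :* (s :* p)) refl (sign i) (fromℕ n - fromℕ i) (u i))
        (cong ((fromℕ n - fromℕ i) *_) (u-even i≤n))

      -- Says that φ vanishes at even i: since N is odd, N - i is then odd, and q lives on even
      -- indices.
      φ-odd : ∀ {i} → i ≤ N → sign i * φ i ≡ - φ i
      φ-odd {i} i≤N = *-cancelˡ-≢0 (choose≢0 i≤N) (begin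
        N choose i * (sign i * φ i)
          ≡⟨ solve 3 (λ b s f → b :* (s :* f) := s :* (b :* f)) refl (N choose i) (sign i) (φ i) ⟩
        sign i * (N choose i * φ i)
          ≡⟨ cong (sign i *_) (choose*φ i≤N) ⟩
        sign i * - q (N ∸ i)
          ≡⟨ solve 2 (λ s q → s :* (:- q) := con (- 1ℚ) :* s :* q) refl (sign i) (q (N ∸ i)) ⟩
        - 1ℚ * sign i * q (N ∸ i)
          ≡⟨ cong (λ t → t * sign i * q (N ∸ i)) N-odd ⟨
        sign N * sign i * q (N ∸ i)
          ≡⟨ cong (_* q (N ∸ i)) (sign-∸ i≤N) ⟨
        sign (N ∸ i) * q (N ∸ i)
          ≡⟨ q-even (ℕₚ.≤-trans (ℕₚ.m∸n≤m N i) (ℕₚ.n≤1+n N)) ⟩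
        q (N ∸ i)
          ≡⟨ solve 1 (λ q → q := :- (:- q)) refl (q (N ∸ i)) ⟩
        - - q (N ∸ i)
          ≡⟨ cong -_ (choose*φ i≤N) ⟨
        - (N choose i * φ i)
          ≡⟨ solve 2 (λ a b → :- (a :* b) := a :* (:- b)) refl (N choose i) (φ i) ⟩
        N choose i * - φ i ∎)

      -- `choose*e` is read at N - x and carried back by the antisymmetry of e. There the binomials
      -- are C(i, N - x), and reversing the sum brings them into the shape of `choose-trinomial`.
      e≡φ+φ̂ : ∀ {x} → x ≤ N → e x ≡ φ x + transform φ x
      e≡φ+φ̂ {x} x≤N = *-cancelˡ-≢0 (choose≢0 x≤N) (begin
        N choose x * e x
          ≡⟨ solve 2 (λ b e → b :* e := :- (b :* (:- e))) refl (N choose x) (e x) ⟩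
        - (N choose x * - e x)
          ≡⟨ cong₂ (λ s t → - (s * t)) (choose-sym x≤N) (e-antisym x≤N) ⟨
        - (N choose (N ∸ x) * e (N ∸ x))
          ≡⟨ cong -_ (choose*e (ℕₚ.m∸n≤m N x)) ⟩
        - (q (N ∸ x) - ∑< (suc n) (λ i → i choose (N ∸ x) * q i))
          ≡⟨ cong (λ t → - (q (N ∸ x) - t)) reversed ⟩
        - (q (N ∸ x) - N choose x * transform φ x)
          ≡⟨ solve 2 (λ a b → :- (a :- b) := :- a :+ b) refl (q (N ∸ x)) (N choose x * transform φ x) ⟩
        - q (N ∸ x) + N choose x * transform φ x
          ≡⟨ cong (_+ N choose x * transform φ x) (choose*φ x≤N) ⟨
        N choose x * φ x + N choose x * transform φ x
          ≡⟨ ℚₚ.*-distribˡ-+ (N choose x) (φ x) (transform φ x) ⟨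
        N choose x * (φ x + transform φ x) ∎)
        where
        term : ∀ {i} → i ≤ N → (N ∸ i) choose (N ∸ x) * q (N ∸ i) ≡ N choose x * (x choose i * (sign i * φ i))
        term {i} i≤N = begin
          (N ∸ i) choose (N ∸ x) * q (N ∸ i)
            ≡⟨ solve 2 (λ b q → b :* q := :- (b :* (:- q))) refl ((N ∸ i) choose (N ∸ x)) (q (N ∸ i)) ⟩
          - ((N ∸ i) choose (N ∸ x) * - q (N ∸ i))
            ≡⟨ cong (λ t → - ((N ∸ i) choose (N ∸ x) * t)) (choose*φ i≤N) ⟨
          - ((N ∸ i) choose (N ∸ x) * (N choose i * φ i))
            ≡⟨ solve 3 (λ a b c → :- (a :* (b :* c)) := b :* a :* (:- c)) refl ((N ∸ i) choose (N ∸ x)) (N choose i) (φ i) ⟩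
          N choose i * (N ∸ i) choose (N ∸ x) * - φ i
            -- The alternating sign of T is not present in the sum; the parity of φ supplies it.
            ≡⟨ cong₂ _*_ (choose-trinomial x≤N i≤N) (sym (φ-odd i≤N)) ⟩
          N choose x * x choose i * (sign i * φ i)
            ≡⟨ ℚₚ.*-assoc (N choose x) (x choose i) (sign i * φ i) ⟩
          N choose x * (x choose i * (sign i * φ i)) ∎
        -- The sum over n + 1 terms is reversed by i ↦ n - i. Its first term is then the one with
        -- `q n`; dropping it leaves the reflection i ↦ N - i on n terms.
        q[n]≡0 : q n ≡ 0ℚ
        q[n]≡0 = solve 2 (λ n p → (n :- n) :* p := con 0ℚ) refl (fromℕ n) (u n)
        reversed : ∑< (suc n) (λ i → i choose (N ∸ x) * q i) ≡ N choose x * transform φ x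
        reversed = begin
          ∑< (suc n) (λ i → i choose (N ∸ x) * q i)
            ≡⟨ ∑<-reverse n (λ i → i choose (N ∸ x) * q i) ⟩
          ∑< (suc n) (λ i → (n ∸ i) choose (N ∸ x) * q (n ∸ i))
            ≡⟨ ∑<-suc n (λ i → (n ∸ i) choose (N ∸ x) * q (n ∸ i)) ⟩
          n choose (N ∸ x) * q n + ∑< n (λ i → (N ∸ i) choose (N ∸ x) * q (N ∸ i))
            ≡⟨ cong₂ (λ s t → n choose (N ∸ x) * s + t) q[n]≡0 (∑<-cong n (λ { (s≤s i≤N) → term i≤N })) ⟩
          n choose (N ∸ x) * 0ℚ + ∑< n (λ i → N choose x * (x choose i * (sign i * φ i)))
            ≡⟨ cong₂ _+_ (ℚₚ.*-zeroʳ (n choose (N ∸ x))) (∑<-*ˡ n (N choose x) (λ i → x choose i * (sign i * φ i))) ⟩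
          0ℚ + N choose x * ∑< n (λ i → x choose i * (sign i * φ i))
            ≡⟨ ℚₚ.+-identityˡ _ ⟩
          N choose x * ∑< n (λ i → x choose i * (sign i * φ i))
            ≡⟨ cong (N choose x *_) (transform-sum φ x≤N) ⟨
          N choose x * transform φ x ∎

      e-self-dual : ∀ {r} → r ≤ N → ∑< (suc N) (λ i → r choose i * (sign i * e i)) ≡ e r
      e-self-dual {r} r≤N = begin
        ∑< (suc N) (λ i → r choose i * (sign i * e i))
          ≡⟨ ∑<-cong (suc N) (λ { {i} (s≤s i≤N) → cong (λ t → r choose i * (sign i * t)) (e≡φ+φ̂ i≤N) }) ⟩
        ∑< (suc N) (λ i → r choose i * (sign i * (φ i + transform φ i)))
          ≡⟨ transform-sum (λ i → φ i + transform φ i) r≤N ⟨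
        transform (λ i → φ i + transform φ i) r
          ≡⟨ transform-+ φ (transform φ) r ⟩
        transform φ r + transform (transform φ) r
          ≡⟨ cong (transform φ r +_) (transform-involutive φ r) ⟩
        transform φ r + φ r
          ≡⟨ ℚₚ.+-comm (transform φ r) (φ r) ⟩
        φ r + transform φ r
          ≡⟨ e≡φ+φ̂ r≤N ⟨
        e r ∎

      φ[0]≡0 : φ 0 ≡ 0ℚ
      φ[0]≡0 = x≡-x⇒x≡0 (trans (sym (ℚₚ.*-identityˡ (φ 0))) (φ-odd z≤n))

    selfDual : SelfDual N e
    selfDual = record
      { antisym   = e-antisym
      ; self-dual = e-self-dual
      ; e[0]≡0    = trans (e≡φ+φ̂ z≤n) (cong₂ _+_ φ[0]≡0 φ[0]≡0)
      -- (Tφ)(1) = φ(0) - φ(1), so e(1) collapses to φ(0).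
      ; e[1]≡0    = λ 1≤N → trans (e≡φ+φ̂ 1≤N) (trans
          (solve 2 (λ x y → y :+ (x :- y) := x) refl (φ 0) (φ 1)) φ[0]≡0)
      }

-- Coefficients of powers and products of linear forms

module _ where
  open ≡-Reasoning

  opaque
    unfolding ∑<

    ∑<-comm : ∀ m n (f : ℕ → ℕ → ℚ) →
      ∑< m (λ i → ∑< n (f i)) ≡ ∑< n (λ j → ∑< m (λ i → f i j))
    ∑<-comm m n f = ∑-comm {m} {n} (λ i j → f (toℕ i) (toℕ j))

    ⊛-coeff : ∀ f g i j →
      (f ⊛ g) i j ≡ ∑< (suc i) (λ a → ∑< (suc j) (λ b → f a b * g (i ∸ a) (j ∸ b)))
    ⊛-coeff f g i j = refl

    sum-toℕ : ∀ {n} (u : Fin n → ℚ) (f : ℕ → ℚ) → (∀ x → u x ≡ f (toℕ x)) → sum u ≡ ∑< n f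
    sum-toℕ u f = sum-cong-≗

  ∑∑-cong : ∀ m n {f g : ℕ → ℕ → ℚ} → (∀ {i j} → i < m → j < n → f i j ≡ g i j) →
    ∑< m (λ i → ∑< n (f i)) ≡ ∑< m (λ i → ∑< n (g i))
  ∑∑-cong m n f≡g = ∑<-cong m (λ i<m → ∑<-cong n (f≡g i<m))

  ⊛-cong : ∀ {f f′ g g′} → f ≈ᴾ f′ → g ≈ᴾ g′ → f ⊛ g ≈ᴾ f′ ⊛ g′
  ⊛-cong {f} {f′} {g} {g′} f≈f′ g≈g′ i j = begin
    (f ⊛ g) i j    ≡⟨ ⊛-coeff f g i j ⟩
    _              ≡⟨ ∑∑-cong (suc i) (suc j) (λ {a} {b} _ _ → cong₂ _*_ (f≈f′ a b) (g≈g′ (i ∸ a) (j ∸ b))) ⟩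
    _              ≡⟨ ⊛-coeff f′ g′ i j ⟨
    (f′ ⊛ g′) i j  ∎

  ⊛-comm : ∀ f g → f ⊛ g ≈ᴾ g ⊛ f
  ⊛-comm f g i j = begin
    (f ⊛ g) i j
      ≡⟨ ⊛-coeff f g i j ⟩
    ∑< (suc i) (λ a → ∑< (suc j) (λ b → f a b * g (i ∸ a) (j ∸ b)))
      ≡⟨ ∑<-reverse i (λ a → ∑< (suc j) (λ b → f a b * g (i ∸ a) (j ∸ b))) ⟩
    ∑< (suc i) (λ a → ∑< (suc j) (λ b → f (i ∸ a) b * g (i ∸ (i ∸ a)) (j ∸ b)))
      ≡⟨ ∑<-cong (suc i) (λ {a} _ → ∑<-reverse j (λ b → f (i ∸ a) b * g (i ∸ (i ∸ a)) (j ∸ b))) ⟩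
    ∑< (suc i) (λ a → ∑< (suc j) (λ b → f (i ∸ a) (j ∸ b) * g (i ∸ (i ∸ a)) (j ∸ (j ∸ b))))
      ≡⟨ ∑∑-cong (suc i) (suc j) (λ { {a} {b} (s≤s a≤i) (s≤s b≤j) → trans
           (cong₂ (λ s t → f (i ∸ a) (j ∸ b) * g s t) (ℕₚ.m∸[m∸n]≡n a≤i) (ℕₚ.m∸[m∸n]≡n b≤j))
           (ℚₚ.*-comm (f (i ∸ a) (j ∸ b)) (g a b)) }) ⟩
    ∑< (suc i) (λ a → ∑< (suc j) (λ b → g a b * f (i ∸ a) (j ∸ b)))
      ≡⟨ ⊛-coeff g f i j ⟨
    (g ⊛ f) i j ∎

  -- Exchanges X and Y, so that facts about multiplication by Y follow from those about X.
  transpose : Poly → Poly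
  transpose f i j = f j i

  transpose-⊛ : ∀ f g → transpose (f ⊛ g) ≈ᴾ transpose f ⊛ transpose g
  transpose-⊛ f g i j = begin
    (f ⊛ g) j i
      ≡⟨ ⊛-coeff f g j i ⟩
    ∑< (suc j) (λ a → ∑< (suc i) (λ b → f a b * g (j ∸ a) (i ∸ b)))
      ≡⟨ ∑<-comm (suc j) (suc i) (λ a b → f a b * g (j ∸ a) (i ∸ b)) ⟩
    ∑< (suc i) (λ b → ∑< (suc j) (λ a → f a b * g (j ∸ a) (i ∸ b)))
      ≡⟨ ⊛-coeff (transpose f) (transpose g) i j ⟨
    (transpose f ⊛ transpose g) i j ∎

  transpose-X : transpose X ≈ᴾ Y
  transpose-X zero          zero          = refl
  transpose-X zero          (suc zero)    = refl
  transpose-X zero          (suc (suc _)) = refl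
  transpose-X (suc _)       zero          = refl
  transpose-X (suc _)       (suc zero)    = refl
  transpose-X (suc _)       (suc (suc _)) = refl

  transpose-𝟏 : transpose 𝟏 ≈ᴾ 𝟏
  transpose-𝟏 zero    zero    = refl
  transpose-𝟏 zero    (suc _) = refl
  transpose-𝟏 (suc _) zero    = refl
  transpose-𝟏 (suc _) (suc _) = refl

  transpose-X^ : ∀ m → transpose (X ^ᴾ m) ≈ᴾ Y ^ᴾ m
  transpose-X^ zero    = transpose-𝟏
  transpose-X^ (suc m) i j = trans (transpose-⊛ X (X ^ᴾ m) i j)
    (⊛-cong {transpose X} {Y} {transpose (X ^ᴾ m)} {Y ^ᴾ m} transpose-X (transpose-X^ m) i j)

  ∑∑-zero : ∀ m n {f : ℕ → ℕ → ℚ} → (∀ {i j} → i < m → j < n → f i j ≡ 0ℚ) →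
    ∑< m (λ i → ∑< n (f i)) ≡ 0ℚ
  ∑∑-zero m n f≡0 = trans (∑<-cong m (λ i<m → trans (∑<-cong n (f≡0 i<m)) (∑<-zero n))) (∑<-zero m)

  ∑∑-single : ∀ m n {f : ℕ → ℕ → ℚ} {k l} → k < m → l < n →
    (∀ {i j} → i ≢ k → f i j ≡ 0ℚ) → (∀ {j} → j ≢ l → f k j ≡ 0ℚ) →
    ∑< m (λ i → ∑< n (f i)) ≡ f k l
  ∑∑-single m n {f} {k} k<m l<n f≡0 fk≡0 = trans
    (∑<-single m {λ i → ∑< n (f i)} k<m
      (λ _ i≢k → trans (∑<-cong n (λ _ → f≡0 i≢k)) (∑<-zero n)))
    (∑<-single n {f k} l<n (λ _ → fk≡0))

  X⊛-zero : ∀ g j → (X ⊛ g) 0 j ≡ 0ℚ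
  X⊛-zero g j = trans (⊛-coeff X g 0 j)
    (∑∑-zero 1 (suc j) (λ { {zero} {b} _ _ → ℚₚ.*-zeroˡ (g 0 (j ∸ b)) ; {suc _} (s≤s ()) _ }))

  X⊛-suc : ∀ g i j → (X ⊛ g) (suc i) j ≡ g i j
  X⊛-suc g i j = trans (⊛-coeff X g (suc i) j) (trans
    (∑∑-single (2 ℕ.+ i) (suc j) (s≤s (s≤s z≤n)) (s≤s z≤n)
      (λ {a} {b} → away a b) (λ {b} → away₁ b))
    (ℚₚ.*-identityˡ (g i j)))
    where
    away : ∀ a b → a ≢ 1 → X a b * g (suc i ∸ a) (j ∸ b) ≡ 0ℚ
    away zero          b _   = ℚₚ.*-zeroˡ (g (suc i) (j ∸ b))
    away (suc zero)    b 1≢1 = contradiction refl 1≢1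
    away (suc (suc a)) b _   = ℚₚ.*-zeroˡ (g (i ∸ suc a) (j ∸ b))
    away₁ : ∀ b → b ≢ 0 → X 1 b * g i (j ∸ b) ≡ 0ℚ
    away₁ zero    0≢0 = contradiction refl 0≢0
    away₁ (suc b) _   = ℚₚ.*-zeroˡ (g i (j ∸ suc b))

  𝟏⊛ : ∀ g → 𝟏 ⊛ g ≈ᴾ g
  𝟏⊛ g i j = trans (⊛-coeff 𝟏 g i j) (trans
    (∑∑-single (suc i) (suc j) (s≤s z≤n) (s≤s z≤n) (λ {a} {b} → away a b) (λ {b} → away₀ b))
    (ℚₚ.*-identityˡ (g i j)))
    where
    away : ∀ a b → a ≢ 0 → 𝟏 a b * g (i ∸ a) (j ∸ b) ≡ 0ℚ
    away zero    b 0≢0 = contradiction refl 0≢0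
    away (suc a) b _   = ℚₚ.*-zeroˡ (g (i ∸ suc a) (j ∸ b))
    away₀ : ∀ b → b ≢ 0 → 𝟏 0 b * g i (j ∸ b) ≡ 0ℚ
    away₀ zero    0≢0 = contradiction refl 0≢0
    away₀ (suc b) _   = ℚₚ.*-zeroˡ (g i (j ∸ suc b))

  -- Multiplication by X shifts the first exponent, and the shift passes through the convolution
  -- because the entries of X ⊛ f with exponent 0 vanish.
  X⊛-assoc : ∀ f g → (X ⊛ f) ⊛ g ≈ᴾ X ⊛ (f ⊛ g)
  X⊛-assoc f g zero j = trans (⊛-coeff (X ⊛ f) g 0 j) (trans
    (∑∑-zero 1 (suc j) (λ { {zero} {b} _ _ → trans (cong (_* g 0 (j ∸ b)) (X⊛-zero f b)) (ℚₚ.*-zeroˡ (g 0 (j ∸ b)))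
                          ; {suc _} (s≤s ()) _ }))
    (sym (X⊛-zero (f ⊛ g) j)))
  X⊛-assoc f g (suc i) j = begin
    ((X ⊛ f) ⊛ g) (suc i) j
      ≡⟨ ⊛-coeff (X ⊛ f) g (suc i) j ⟩
    ∑< (2 ℕ.+ i) (λ a → ∑< (suc j) (λ b → (X ⊛ f) a b * g (suc i ∸ a) (j ∸ b)))
      ≡⟨ ∑<-suc (suc i) (λ a → ∑< (suc j) (λ b → (X ⊛ f) a b * g (suc i ∸ a) (j ∸ b))) ⟩
    ∑< (suc j) (λ b → (X ⊛ f) 0 b * g (suc i) (j ∸ b))
      + ∑< (suc i) (λ a → ∑< (suc j) (λ b → (X ⊛ f) (suc a) b * g (i ∸ a) (j ∸ b)))
      ≡⟨ cong₂ _+_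
           (trans (∑<-cong (suc j) (λ {b} _ → trans (cong (_* g (suc i) (j ∸ b)) (X⊛-zero f b))
                                                    (ℚₚ.*-zeroˡ (g (suc i) (j ∸ b)))))
                  (∑<-zero (suc j)))
           (∑∑-cong (suc i) (suc j) (λ {a} {b} _ _ → cong (_* g (i ∸ a) (j ∸ b)) (X⊛-suc f a b))) ⟩
    0ℚ + ∑< (suc i) (λ a → ∑< (suc j) (λ b → f a b * g (i ∸ a) (j ∸ b)))
      ≡⟨ ℚₚ.+-identityˡ _ ⟩
    ∑< (suc i) (λ a → ∑< (suc j) (λ b → f a b * g (i ∸ a) (j ∸ b)))
      ≡⟨ ⊛-coeff f g i j ⟨
    (f ⊛ g) i j
      ≡⟨ X⊛-suc (f ⊛ g) i j ⟨
    (X ⊛ (f ⊛ g)) (suc i) j ∎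

  X^⊛-≥ : ∀ b g i j → (X ^ᴾ b ⊛ g) (b ℕ.+ i) j ≡ g i j
  X^⊛-≥ zero    g i j = 𝟏⊛ g i j
  X^⊛-≥ (suc b) g i j = trans (X⊛-assoc (X ^ᴾ b) g (suc (b ℕ.+ i)) j)
    (trans (X⊛-suc (X ^ᴾ b ⊛ g) (b ℕ.+ i) j) (X^⊛-≥ b g i j))

  X^⊛-< : ∀ {b} g {i} j → i < b → (X ^ᴾ b ⊛ g) i j ≡ 0ℚ
  X^⊛-< {suc b} g {zero}  j _         = trans (X⊛-assoc (X ^ᴾ b) g 0 j) (X⊛-zero (X ^ᴾ b ⊛ g) j)
  X^⊛-< {suc b} g {suc i} j (s≤s i<b) = trans (X⊛-assoc (X ^ᴾ b) g (suc i) j)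
    (trans (X⊛-suc (X ^ᴾ b ⊛ g) i j) (X^⊛-< g j i<b))

  Y^⊛ : ∀ b g i j → (Y ^ᴾ b ⊛ g) i j ≡ (X ^ᴾ b ⊛ transpose g) j i
  Y^⊛ b g i j = sym (trans (transpose-⊛ (X ^ᴾ b) (transpose g) i j)
    (⊛-cong {transpose (X ^ᴾ b)} {Y ^ᴾ b} {g} {g} (transpose-X^ b) (λ _ _ → refl) i j))

  Y⊛ : ∀ g i j → (Y ⊛ g) i j ≡ (X ⊛ transpose g) j i
  Y⊛ g i j = sym (trans (transpose-⊛ X (transpose g) i j) (⊛-cong {transpose X} {Y} {g} {g} transpose-X (λ _ _ → refl) i j))

  -- Powers of linear forms αX + βY

  record LinearForm (α β : ℚ) (L : Poly) : Set where
    constructor linear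
    field coeffs : L ≈ᴾ α ⊙ X ⊕ β ⊙ Y

  linear-⊛ : ∀ {α β L} → LinearForm α β L → ∀ g i j →
    (L ⊛ g) i j ≡ α * (X ⊛ g) i j + β * (Y ⊛ g) i j
  linear-⊛ {α} {β} {L} (linear L≈) g i j = begin
    (L ⊛ g) i j
      ≡⟨ ⊛-coeff L g i j ⟩
    ∑< (suc i) (λ a → ∑< (suc j) (λ b → L a b * g (i ∸ a) (j ∸ b)))
      ≡⟨ ∑∑-cong (suc i) (suc j) (λ {a} {b} _ _ → trans
           (cong (_* g (i ∸ a) (j ∸ b)) (L≈ a b))
           (solve 5 (λ α β x y g → (α :* x :+ β :* y) :* g := α :* (x :* g) :+ β :* (y :* g)) refl
              α β (X a b) (Y a b) (g (i ∸ a) (j ∸ b)))) ⟩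
    ∑< (suc i) (λ a → ∑< (suc j) (λ b → α * u a b + β * v a b))
      ≡⟨ ∑<-cong (suc i) (λ {a} _ → trans (∑<-+ (suc j) (λ b → α * u a b) (λ b → β * v a b))
           (cong₂ _+_ (∑<-*ˡ (suc j) α (u a)) (∑<-*ˡ (suc j) β (v a)))) ⟩
    ∑< (suc i) (λ a → α * ∑< (suc j) (u a) + β * ∑< (suc j) (v a))
      ≡⟨ trans (∑<-+ (suc i) (λ a → α * ∑< (suc j) (u a)) (λ a → β * ∑< (suc j) (v a)))
           (cong₂ _+_ (∑<-*ˡ (suc i) α (λ a → ∑< (suc j) (u a))) (∑<-*ˡ (suc i) β (λ a → ∑< (suc j) (v a)))) ⟩
    α * ∑< (suc i) (λ a → ∑< (suc j) (u a)) + β * ∑< (suc i) (λ a → ∑< (suc j) (v a))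
      ≡⟨ cong₂ (λ s t → α * s + β * t) (⊛-coeff X g i j) (⊛-coeff Y g i j) ⟨
    α * (X ⊛ g) i j + β * (Y ⊛ g) i j ∎
    where
    u v : ℕ → ℕ → ℚ
    u a b = X a b * g (i ∸ a) (j ∸ b)
    v a b = Y a b * g (i ∸ a) (j ∸ b)

  -- The binomial theorem by Pascal's rule, for entries of total degree m. The entries on the two
  -- axes are separate cases, since there only one of the factors X and Y contributes.
  linear-^ : ∀ {α β L} → LinearForm α β L → ∀ {m} i j → i ℕ.+ j ≡ m →
    (L ^ᴾ m) i j ≡ m choose i * (α ^ i * β ^ j)
  linear-^ L≈ zero zero refl = cong (_* (1ℚ * 1ℚ)) (sym (choose-zero 0))
  linear-^ {α} {β} {L} L≈ zero (suc j) refl = begin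
    (L ⊛ L ^ᴾ j) 0 (suc j)
      ≡⟨ linear-⊛ L≈ (L ^ᴾ j) 0 (suc j) ⟩
    α * (X ⊛ L ^ᴾ j) 0 (suc j) + β * (Y ⊛ L ^ᴾ j) 0 (suc j)
      ≡⟨ cong₂ (λ s t → α * s + β * t) (X⊛-zero (L ^ᴾ j) (suc j))
           (trans (Y⊛ (L ^ᴾ j) 0 (suc j)) (X⊛-suc (transpose (L ^ᴾ j)) j 0)) ⟩
    α * 0ℚ + β * (L ^ᴾ j) 0 j
      ≡⟨ cong (λ t → α * 0ℚ + β * t) (linear-^ L≈ 0 j refl) ⟩
    α * 0ℚ + β * (j choose 0 * (1ℚ * β ^ j))
      ≡⟨ solve 4 (λ a b c d → a :* con 0ℚ :+ b :* (c :* (con 1ℚ :* d)) := c :* (con 1ℚ :* (b :* d))) refl α β (j choose 0) (β ^ j) ⟩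
    j choose 0 * (1ℚ * (β * β ^ j))
      ≡⟨ cong (_* (1ℚ * (β * β ^ j))) (trans (choose-zero j) (sym (choose-zero (suc j)))) ⟩
    suc j choose 0 * (1ℚ * (β * β ^ j)) ∎
  linear-^ {α} {β} {L} L≈ (suc i) zero refl = begin
    (L ⊛ L ^ᴾ (i ℕ.+ 0)) (suc i) 0
      ≡⟨ linear-⊛ L≈ (L ^ᴾ (i ℕ.+ 0)) (suc i) 0 ⟩
    α * (X ⊛ L ^ᴾ (i ℕ.+ 0)) (suc i) 0 + β * (Y ⊛ L ^ᴾ (i ℕ.+ 0)) (suc i) 0
      ≡⟨ cong₂ (λ s t → α * s + β * t) (X⊛-suc (L ^ᴾ (i ℕ.+ 0)) i 0)
           (trans (Y⊛ (L ^ᴾ (i ℕ.+ 0)) (suc i) 0) (X⊛-zero (transpose (L ^ᴾ (i ℕ.+ 0))) (suc i))) ⟩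
    α * (L ^ᴾ (i ℕ.+ 0)) i 0 + β * 0ℚ
      ≡⟨ cong (λ t → α * t + β * 0ℚ) (linear-^ L≈ i 0 refl) ⟩
    α * ((i ℕ.+ 0) choose i * (α ^ i * 1ℚ)) + β * 0ℚ
      ≡⟨ solve 4 (λ a b c d → a :* (c :* (d :* con 1ℚ)) :+ b :* con 0ℚ := c :* (a :* d :* con 1ℚ)) refl α β ((i ℕ.+ 0) choose i) (α ^ i) ⟩
    (i ℕ.+ 0) choose i * (α * α ^ i * 1ℚ)
      -- On this axis Pascal's rule has only one nonzero term.
      ≡⟨ cong (_* (α * α ^ i * 1ℚ)) (begin
           (i ℕ.+ 0) choose i                ≡⟨ ℚₚ.+-identityʳ ((i ℕ.+ 0) choose i) ⟨
           (i ℕ.+ 0) choose i + 0ℚ           ≡⟨ cong ((i ℕ.+ 0) choose i +_) (choose-> (s≤s (ℕₚ.≤-reflexive (ℕₚ.+-identityʳ i)))) ⟨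
           (i ℕ.+ 0) choose i + (i ℕ.+ 0) choose suc i  ≡⟨ pascal (i ℕ.+ 0) i ⟨
           suc (i ℕ.+ 0) choose suc i        ∎) ⟩
    suc (i ℕ.+ 0) choose suc i * (α * α ^ i * 1ℚ) ∎
  linear-^ {α} {β} {L} L≈ (suc i) (suc j) refl = begin
    (L ⊛ L ^ᴾ m) (suc i) (suc j)
      ≡⟨ linear-⊛ L≈ (L ^ᴾ m) (suc i) (suc j) ⟩
    α * (X ⊛ L ^ᴾ m) (suc i) (suc j) + β * (Y ⊛ L ^ᴾ m) (suc i) (suc j)
      ≡⟨ cong₂ (λ s t → α * s + β * t) (X⊛-suc (L ^ᴾ m) i (suc j))
           (trans (Y⊛ (L ^ᴾ m) (suc i) (suc j)) (X⊛-suc (transpose (L ^ᴾ m)) j (suc i))) ⟩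
    α * (L ^ᴾ m) i (suc j) + β * (L ^ᴾ m) (suc i) j
      ≡⟨ cong₂ (λ s t → α * s + β * t) (linear-^ L≈ i (suc j) refl)
           (linear-^ L≈ (suc i) j (sym (ℕₚ.+-suc i j))) ⟩
    α * (m choose i * (α ^ i * (β * β ^ j))) + β * (m choose suc i * (α * α ^ i * β ^ j))
      ≡⟨ solve 6 (λ a b c d x y → a :* (c :* (x :* (b :* y))) :+ b :* (d :* (a :* x :* y)) := (c :+ d) :* (a :* x :* (b :* y)))
           refl α β (m choose i) (m choose suc i) (α ^ i) (β ^ j) ⟩
    (m choose i + m choose suc i) * (α * α ^ i * (β * β ^ j))
      ≡⟨ cong (_* (α * α ^ i * (β * β ^ j))) (pascal m i) ⟨
    suc m choose suc i * (α * α ^ i * (β * β ^ j)) ∎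
    where m = i ℕ.+ suc j

  -- The factor Xᵇ leaves the exponent j of Y to the power of L. Indexing the binomial by j also
  -- covers i < b: then j > m and both sides vanish.
  X^⊛linear^ : ∀ {α β L} → LinearForm α β L → ∀ {b m i j} → i ℕ.+ j ≡ b ℕ.+ m →
    (X ^ᴾ b ⊛ L ^ᴾ m) i j ≡ m choose j * (α ^ (m ∸ j) * β ^ j)
  X^⊛linear^ {α} {β} {L} L≈ {b} {m} {i} {j} i+j≡b+m with ℕₚ.≤-<-connex b i
  ... | inj₂ i<b = trans (X^⊛-< (L ^ᴾ m) j i<b) (sym (trans
          (cong (_* (α ^ (m ∸ j) * β ^ j)) (choose-> m<j)) (ℚₚ.*-zeroˡ (α ^ (m ∸ j) * β ^ j))))
    where
    m<j : m < j
    m<j = ℕₚ.+-cancelˡ-< b m j (ℕₚ.≤-<-trans (ℕₚ.≤-reflexive (sym i+j≡b+m)) (ℕₚ.+-monoˡ-< j i<b))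
  ... | inj₁ b≤i with ℕₚ.m≤n⇒∃[o]m+o≡n b≤i
  ... | o , refl with ℕₚ.+-cancelˡ-≡ b (o ℕ.+ j) m (trans (sym (ℕₚ.+-assoc b o j)) i+j≡b+m)
  ... | refl = begin
    (X ^ᴾ b ⊛ L ^ᴾ (o ℕ.+ j)) (b ℕ.+ o) j
      ≡⟨ X^⊛-≥ b (L ^ᴾ (o ℕ.+ j)) o j ⟩
    (L ^ᴾ (o ℕ.+ j)) o j
      ≡⟨ linear-^ L≈ o j refl ⟩
    (o ℕ.+ j) choose o * (α ^ o * β ^ j)
      ≡⟨ cong (λ t → (o ℕ.+ j) choose t * (α ^ t * β ^ j)) (ℕₚ.m+n∸n≡m o j) ⟨
    (o ℕ.+ j) choose (o ℕ.+ j ∸ j) * (α ^ (o ℕ.+ j ∸ j) * β ^ j)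
      ≡⟨ cong (_* (α ^ (o ℕ.+ j ∸ j) * β ^ j)) (choose-sym (ℕₚ.m≤n+m j o)) ⟩
    (o ℕ.+ j) choose j * (α ^ (o ℕ.+ j ∸ j) * β ^ j) ∎

  Y^⊛linear^ : ∀ {α β L} → LinearForm α β L → ∀ {b m i j} → i ℕ.+ j ≡ b ℕ.+ m →
    (Y ^ᴾ b ⊛ L ^ᴾ m) i j ≡ m choose i * (α ^ i * β ^ (m ∸ i))
  Y^⊛linear^ {α} {β} {L} L≈ {b} {m} {i} {j} i+j≡b+m = begin
    (Y ^ᴾ b ⊛ L ^ᴾ m) i j                    ≡⟨ Y^⊛ b (L ^ᴾ m) i j ⟩
    (X ^ᴾ b ⊛ transpose (L ^ᴾ m)) j i        ≡⟨ ⊛-cong {X ^ᴾ b} {X ^ᴾ b} {transpose (L ^ᴾ m)} {transpose L ^ᴾ m} (λ _ _ → refl) (transpose-^ m) j i ⟩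
    (X ^ᴾ b ⊛ transpose L ^ᴾ m) j i          ≡⟨ X^⊛linear^ transposed (trans (ℕₚ.+-comm j i) i+j≡b+m) ⟩
    m choose i * (β ^ (m ∸ i) * α ^ i)       ≡⟨ cong (m choose i *_) (ℚₚ.*-comm (β ^ (m ∸ i)) (α ^ i)) ⟩
    m choose i * (α ^ i * β ^ (m ∸ i))       ∎
    where
    transpose-^ : ∀ m → transpose (L ^ᴾ m) ≈ᴾ transpose L ^ᴾ m
    transpose-^ zero    = transpose-𝟏
    transpose-^ (suc m) i j = trans (transpose-⊛ L (L ^ᴾ m) i j)
      (⊛-cong {transpose L} {transpose L} {transpose (L ^ᴾ m)} {transpose L ^ᴾ m} (λ _ _ → refl) (transpose-^ m) i j)
    transposed : LinearForm β α (transpose L)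
    transposed = linear λ i j → trans (LinearForm.coeffs L≈ j i) (trans
      (cong₂ (λ s t → α * s + β * t) (transpose-X i j) (sym (transpose-X j i)))
      (ℚₚ.+-comm (α * Y i j) (β * X i j)))

  -- Substitution of linear forms into a homogeneous polynomial

  extend : ∀ {n} → (Fin n → ℚ) → ℕ → ℚ
  extend {zero}  v _       = 0ℚ
  extend {suc n} v zero    = v zero
  extend {suc n} v (suc i) = extend (v ∘ suc) i

  extend-toℕ : ∀ {n} (v : Fin n → ℚ) x → extend v (toℕ x) ≡ v x
  extend-toℕ v zero    = refl
  extend-toℕ v (suc x) = extend-toℕ (v ∘ suc) x

  substitute-coeff : ∀ {d} (p : Fin (suc d) → ℚ) A B i j →
    (p ⟨ A , B ⟩) i j ≡ ∑< (suc d) (λ m → extend p m * (A ^ᴾ m ⊛ B ^ᴾ (d ∸ m)) i j)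
  substitute-coeff {d} p A B i j = sum-toℕ _ (λ m → extend p m * (A ^ᴾ m ⊛ B ^ᴾ (d ∸ m)) i j)
    (λ x → cong (_* (A ^ᴾ toℕ x ⊛ B ^ᴾ (d ∸ toℕ x)) i j) (sym (extend-toℕ p x)))

  1^ : ∀ m → 1ℚ ^ m ≡ 1ℚ
  1^ zero    = refl
  1^ (suc m) = trans (ℚₚ.*-identityˡ (1ℚ ^ m)) (1^ m)

  -1^ : ∀ m → (- 1ℚ) ^ m ≡ sign m
  -1^ zero    = refl
  -1^ (suc m) = trans (cong (- 1ℚ *_) (-1^ m)) (solve 1 (λ s → con (- 1ℚ) :* s := :- s) refl (sign m))

  linear-X+Y : LinearForm 1ℚ 1ℚ (X ⊕ Y)
  linear-X+Y = linear λ i j → solve 2 (λ x y → x :+ y := con 1ℚ :* x :+ con 1ℚ :* y) refl (X i j) (Y i j)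

  linear-X-Y : LinearForm 1ℚ (- 1ℚ) (X ⊖ Y)
  linear-X-Y = linear λ i j → solve 2 (λ x y → x :+ :- y := con 1ℚ :* x :+ con (- 1ℚ) :* y) refl (X i j) (Y i j)

  linear-Y-X : LinearForm (- 1ℚ) 1ℚ (Y ⊖ X)
  linear-Y-X = linear λ i j → solve 2 (λ x y → y :+ :- x := con (- 1ℚ) :* x :+ con 1ℚ :* y) refl (X i j) (Y i j)

  linear-Y : LinearForm 0ℚ 1ℚ Y
  linear-Y = linear λ i j → solve 2 (λ x y → y := con 0ℚ :* x :+ con 1ℚ :* y) refl (X i j) (Y i j)

  linear--Y : LinearForm 0ℚ (- 1ℚ) (⊝ Y)
  linear--Y = linear λ i j → solve 2 (λ x y → :- y := con 0ℚ :* x :+ con (- 1ℚ) :* y) refl (X i j) (Y i j)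

  -- For L = βY the m-th term is a multiple of the single monomial XᵐYⁿ⁻ᵐ, so only m = i survives.
  -- With β = 1 or -1 this reads off the coefficients of p(X,Y), p(Y,X), p(-Y,X) and of the
  -- expansion that defines c.
  ∑-X^⊛Y^ : ∀ {β L} → LinearForm 0ℚ β L → ∀ {n i j} → i ℕ.+ j ≡ n → ∀ (u : ℕ → ℚ) →
    ∑< (suc n) (λ m → u m * (X ^ᴾ m ⊛ L ^ᴾ (n ∸ m)) i j) ≡ u i * β ^ j
  ∑-X^⊛Y^ {β} {L} L≈ {n} {i} {j} i+j≡n u = trans
    (∑<-single (suc n) (s≤s i≤n) away) (cong (u i *_) here)
    where
    i≤n : i ≤ n
    i≤n = subst (i ≤_) i+j≡n (ℕₚ.m≤m+n i j)
    n∸i≡j : n ∸ i ≡ j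
    n∸i≡j = trans (cong (_∸ i) (sym i+j≡n)) (ℕₚ.m+n∸m≡n i j)
    here : (X ^ᴾ i ⊛ L ^ᴾ (n ∸ i)) i j ≡ β ^ j
    here = begin
      (X ^ᴾ i ⊛ L ^ᴾ (n ∸ i)) i j                 ≡⟨ cong (λ t → (X ^ᴾ i ⊛ L ^ᴾ t) i j) n∸i≡j ⟩
      (X ^ᴾ i ⊛ L ^ᴾ j) i j                       ≡⟨ X^⊛linear^ L≈ {i} {j} {i} {j} refl ⟩
      j choose j * (0ℚ ^ (j ∸ j) * β ^ j)         ≡⟨ cong₂ (λ s t → s * (0ℚ ^ t * β ^ j)) (sym (choose-sym (ℕₚ.≤-refl {j}))) (ℕₚ.n∸n≡0 j) ⟩
      j choose (j ∸ j) * (0ℚ ^ 0 * β ^ j)         ≡⟨ cong (λ t → j choose t * (1ℚ * β ^ j)) (ℕₚ.n∸n≡0 j) ⟩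
      j choose 0 * (1ℚ * β ^ j)                   ≡⟨ cong (_* (1ℚ * β ^ j)) (choose-zero j) ⟩
      1ℚ * (1ℚ * β ^ j)                           ≡⟨ solve 1 (λ x → con 1ℚ :* (con 1ℚ :* x) := x) refl (β ^ j) ⟩
      β ^ j                                       ∎
    vanishing : ∀ m → m ≢ j → m choose j * (0ℚ ^ (m ∸ j) * β ^ j) ≡ 0ℚ
    vanishing m m≢j with ℕₚ.≤-<-connex m j
    ... | inj₁ m≤j = trans (cong (_* (0ℚ ^ (m ∸ j) * β ^ j)) (choose-> (ℕₚ.≤∧≢⇒< m≤j m≢j)))
                           (ℚₚ.*-zeroˡ (0ℚ ^ (m ∸ j) * β ^ j))
    ... | inj₂ j<m with m ∸ j | ℕₚ.m<n⇒0<n∸m j<m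
    ...   | suc o | _ = solve 3 (λ c x y → c :* (con 0ℚ :* x :* y) := con 0ℚ) refl (m choose j) (0ℚ ^ o) (β ^ j)
    away : ∀ {m} → m < suc n → m ≢ i → u m * (X ^ᴾ m ⊛ L ^ᴾ (n ∸ m)) i j ≡ 0ℚ
    away {m} (s≤s m≤n) m≢i = trans
      (cong (u m *_) (trans
        (X^⊛linear^ L≈ {m} {n ∸ m} {i} {j} (trans i+j≡n (sym (ℕₚ.m+[n∸m]≡n m≤n))))
        (vanishing (n ∸ m) (λ n∸m≡j → m≢i (begin
          m             ≡⟨ ℕₚ.m∸[m∸n]≡n m≤n ⟨
          n ∸ (n ∸ m)   ≡⟨ cong (n ∸_) (trans n∸m≡j (sym n∸i≡j)) ⟩
          n ∸ (n ∸ i)   ≡⟨ ℕₚ.m∸[m∸n]≡n i≤n ⟩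
          i             ∎)))))
      (ℚₚ.*-zeroʳ (u m))

  module _ {n} (p : Fin (suc n) → ℚ) {i j} (i+j≡n : i ℕ.+ j ≡ n) where

    private
      P₀ = extend p

      rest : ∀ {m} → m ≤ n → i ℕ.+ j ≡ m ℕ.+ (n ∸ m)
      rest m≤n = trans i+j≡n (sym (ℕₚ.m+[n∸m]≡n m≤n))

    substitute-X,Y : (p ⟨ X , Y ⟩) i j ≡ P₀ i
    substitute-X,Y = begin
      (p ⟨ X , Y ⟩) i j    ≡⟨ substitute-coeff p X Y i j ⟩
      _                    ≡⟨ ∑-X^⊛Y^ linear-Y i+j≡n P₀ ⟩
      P₀ i * 1ℚ ^ j        ≡⟨ cong (P₀ i *_) (1^ j) ⟩
      P₀ i * 1ℚ            ≡⟨ ℚₚ.*-identityʳ (P₀ i) ⟩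
      P₀ i                 ∎

    substitute-L,X : ∀ {β L} → LinearForm 0ℚ β L → (p ⟨ L , X ⟩) i j ≡ P₀ j * β ^ j
    substitute-L,X {β} {L} L≈ = begin
      (p ⟨ L , X ⟩) i j
        ≡⟨ substitute-coeff p L X i j ⟩
      ∑< (suc n) (λ m → P₀ m * (L ^ᴾ m ⊛ X ^ᴾ (n ∸ m)) i j)
        ≡⟨ ∑<-reverse n (λ m → P₀ m * (L ^ᴾ m ⊛ X ^ᴾ (n ∸ m)) i j) ⟩
      ∑< (suc n) (λ m → P₀ (n ∸ m) * (L ^ᴾ (n ∸ m) ⊛ X ^ᴾ (n ∸ (n ∸ m))) i j)
        ≡⟨ ∑<-cong (suc n) (λ { {m} (s≤s m≤n) → cong (P₀ (n ∸ m) *_) (trans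
             (cong (λ t → (L ^ᴾ (n ∸ m) ⊛ X ^ᴾ t) i j) (ℕₚ.m∸[m∸n]≡n m≤n))
             (⊛-comm (L ^ᴾ (n ∸ m)) (X ^ᴾ m) i j)) }) ⟩
      ∑< (suc n) (λ m → P₀ (n ∸ m) * (X ^ᴾ m ⊛ L ^ᴾ (n ∸ m)) i j)
        ≡⟨ ∑-X^⊛Y^ L≈ i+j≡n (λ m → P₀ (n ∸ m)) ⟩
      P₀ (n ∸ i) * β ^ j
        ≡⟨ cong (λ t → P₀ t * β ^ j) (trans (cong (_∸ i) (sym i+j≡n)) (ℕₚ.m+n∸m≡n i j)) ⟩
      P₀ j * β ^ j ∎

    substitute-X+Y,Y : (p ⟨ X ⊕ Y , Y ⟩) i j ≡ binomialSum n P₀ i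
    substitute-X+Y,Y = trans (substitute-coeff p (X ⊕ Y) Y i j)
      (∑<-cong (suc n) (λ { {m} (s≤s m≤n) → cong (P₀ m *_) (begin
        ((X ⊕ Y) ^ᴾ m ⊛ Y ^ᴾ (n ∸ m)) i j        ≡⟨ ⊛-comm ((X ⊕ Y) ^ᴾ m) (Y ^ᴾ (n ∸ m)) i j ⟩
        (Y ^ᴾ (n ∸ m) ⊛ (X ⊕ Y) ^ᴾ m) i j        ≡⟨ Y^⊛linear^ linear-X+Y {n ∸ m} {m} {i} {j}
                                                      (trans (rest m≤n) (ℕₚ.+-comm m (n ∸ m))) ⟩
        m choose i * (1ℚ ^ i * 1ℚ ^ (m ∸ i))     ≡⟨ cong₂ (λ s t → m choose i * (s * t)) (1^ i) (1^ (m ∸ i)) ⟩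
        m choose i * 1ℚ                          ≡⟨ ℚₚ.*-identityʳ (m choose i) ⟩
        m choose i                               ∎) }))

    substitute-X-Y,X : (p ⟨ X ⊖ Y , X ⟩) i j ≡ sign j * binomialSum n P₀ j
    substitute-X-Y,X = trans (substitute-coeff p (X ⊖ Y) X i j) (trans
      (∑<-cong (suc n) (λ { {m} (s≤s m≤n) → trans (cong (P₀ m *_) (begin
        ((X ⊖ Y) ^ᴾ m ⊛ X ^ᴾ (n ∸ m)) i j        ≡⟨ ⊛-comm ((X ⊖ Y) ^ᴾ m) (X ^ᴾ (n ∸ m)) i j ⟩
        (X ^ᴾ (n ∸ m) ⊛ (X ⊖ Y) ^ᴾ m) i j        ≡⟨ X^⊛linear^ linear-X-Y {n ∸ m} {m} {i} {j}
                                                      (trans (rest m≤n) (ℕₚ.+-comm m (n ∸ m))) ⟩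
        m choose j * (1ℚ ^ (m ∸ j) * (- 1ℚ) ^ j) ≡⟨ cong₂ (λ s t → m choose j * (s * t)) (1^ (m ∸ j)) (-1^ j) ⟩
        m choose j * (1ℚ * sign j)               ∎))
        (solve 3 (λ p b s → p :* (b :* (con 1ℚ :* s)) := s :* (p :* b)) refl (P₀ m) (m choose j) (sign j)) }))
      (∑<-*ˡ (suc n) (sign j) (λ m → P₀ m * m choose j)))

    -- Reversing the sum makes the power of Y - X the summation index, which brings it into the
    -- shape of `binomialSum` with reflected coefficients.
    substitute-Y,Y-X : (p ⟨ Y , Y ⊖ X ⟩) i j ≡ sign i * binomialSum n (λ m → P₀ (n ∸ m)) i
    substitute-Y,Y-X = begin
      (p ⟨ Y , Y ⊖ X ⟩) i j
        ≡⟨ substitute-coeff p Y (Y ⊖ X) i j ⟩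
      ∑< (suc n) (λ m → P₀ m * (Y ^ᴾ m ⊛ (Y ⊖ X) ^ᴾ (n ∸ m)) i j)
        ≡⟨ ∑<-cong (suc n) (λ { {m} (s≤s m≤n) → cong (P₀ m *_) (begin
             (Y ^ᴾ m ⊛ (Y ⊖ X) ^ᴾ (n ∸ m)) i j
               ≡⟨ Y^⊛linear^ linear-Y-X {m} {n ∸ m} {i} {j} (rest m≤n) ⟩
             (n ∸ m) choose i * ((- 1ℚ) ^ i * 1ℚ ^ (n ∸ m ∸ i))
               ≡⟨ cong₂ (λ s t → (n ∸ m) choose i * (s * t)) (-1^ i) (1^ (n ∸ m ∸ i)) ⟩
             (n ∸ m) choose i * (sign i * 1ℚ) ∎) }) ⟩
      ∑< (suc n) (λ m → P₀ m * ((n ∸ m) choose i * (sign i * 1ℚ)))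
        ≡⟨ ∑<-reverse n (λ m → P₀ m * ((n ∸ m) choose i * (sign i * 1ℚ))) ⟩
      ∑< (suc n) (λ m → P₀ (n ∸ m) * ((n ∸ (n ∸ m)) choose i * (sign i * 1ℚ)))
        ≡⟨ ∑<-cong (suc n) (λ { {m} (s≤s m≤n) → trans
             (cong (λ t → P₀ (n ∸ m) * (t choose i * (sign i * 1ℚ))) (ℕₚ.m∸[m∸n]≡n m≤n))
             (solve 3 (λ p b s → p :* (b :* (s :* con 1ℚ)) := s :* (p :* b)) refl (P₀ (n ∸ m)) (m choose i) (sign i)) }) ⟩
      ∑< (suc n) (λ m → sign i * (P₀ (n ∸ m) * m choose i))
        ≡⟨ ∑<-*ˡ (suc n) (sign i) (λ m → P₀ (n ∸ m) * m choose i) ⟩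
      sign i * binomialSum n (λ m → P₀ (n ∸ m)) i ∎

  -- The relations of W⁻ on coefficients

  module PeriodPolynomial {n} (n-even : sign n ≡ 1ℚ) (p : V (2 ℕ.+ n)) (p∈W⁻ : p ∈ W⁻ (2 ℕ.+ n)) where

    private
      P₀ = extend p
      S  = binomialSum n P₀

      sign-reflect : ∀ {a} → a ≤ n → sign (n ∸ a) ≡ sign a
      sign-reflect {a} a≤n = trans (sign-∸ a≤n) (trans (cong (_* sign a) n-even) (ℚₚ.*-identityˡ (sign a)))

    antisymmetric : ∀ {a} → a ≤ n → P₀ (n ∸ a) ≡ - P₀ a
    antisymmetric {a} a≤n = begin
      P₀ (n ∸ a)
        ≡⟨ solve 1 (λ x → x := :- (:- (x :* con 1ℚ))) refl (P₀ (n ∸ a)) ⟩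
      - - (P₀ (n ∸ a) * 1ℚ)
        ≡⟨ cong (λ t → - - (P₀ (n ∸ a) * t)) (1^ (n ∸ a)) ⟨
      - - (P₀ (n ∸ a) * 1ℚ ^ (n ∸ a))
        ≡⟨ cong (λ t → - - t) (substitute-L,X p a+b≡n linear-Y) ⟨
      - - (p ⟨ Y , X ⟩) a (n ∸ a)
        ≡⟨ cong -_ (proj₂ p∈W⁻ a (n ∸ a)) ⟨
      - (p ⟨ X , Y ⟩) a (n ∸ a)
        ≡⟨ cong -_ (substitute-X,Y p a+b≡n) ⟩
      - P₀ a ∎
      where a+b≡n = ℕₚ.m+[n∸m]≡n a≤n

    -- p(-Y,X) contributes (-1)ⁿ⁻ᵃ u(n - a), which is - (-1)ᵃ u(a) because n is even and u is
    -- antisymmetric. The two-term relation then compares u(a) with (-1)ᵃ u(a).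
    even : ∀ {a} → a ≤ n → sign a * P₀ a ≡ P₀ a
    even {a} a≤n = begin
      sign a * P₀ a
        ≡⟨ solve 2 (λ s p → s :* p := p :- (p :+ (:- p) :* s)) refl (sign a) (P₀ a) ⟩
      P₀ a - (P₀ a + - P₀ a * sign a)
        ≡⟨ cong₂ (λ s t → P₀ a - (P₀ a + s * t)) (antisymmetric a≤n) (sign-reflect a≤n) ⟨
      P₀ a - (P₀ a + P₀ (n ∸ a) * sign (n ∸ a))
        ≡⟨ cong (λ t → P₀ a - (P₀ a + P₀ (n ∸ a) * t)) (-1^ (n ∸ a)) ⟨
      P₀ a - (P₀ a + P₀ (n ∸ a) * (- 1ℚ) ^ (n ∸ a))
        ≡⟨ cong (λ t → P₀ a - t) (trans
             (sym (cong₂ _+_ (substitute-X,Y p a+b≡n) (substitute-L,X p a+b≡n linear--Y)))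
             (W.two-term (proj₁ p∈W⁻) a (n ∸ a))) ⟩
      P₀ a - 0ℚ
        ≡⟨ solve 1 (λ x → x :- con 0ℚ := x) refl (P₀ a) ⟩
      P₀ a ∎
      where a+b≡n = ℕₚ.m+[n∸m]≡n a≤n

    -- The three-term relation at XᵃYⁿ⁻ᵃ is u(a) + (-1)ᵃ S(n - a) - (-1)ᵃ S(a) = 0. Multiplying by
    -- (-1)ᵃ clears the signs, as u(a) is unchanged by `even`.
    period : ∀ {a} → a ≤ n → P₀ a ≡ S a - S (n ∸ a)
    period {a} a≤n = begin
      P₀ a
        ≡⟨ even a≤n ⟨
      sign a * P₀ a
        ≡⟨ solve 4 (λ s p x y → s :* p := s :* (p :+ s :* y :+ s :* (:- x)) :+ s :* s :* (x :- y)) refl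
             (sign a) (P₀ a) (S a) (S (n ∸ a)) ⟩
      sign a * (P₀ a + sign a * S (n ∸ a) + sign a * - S a) + sign a * sign a * (S a - S (n ∸ a))
        ≡⟨ cong₂ (λ s t → sign a * s + t * (S a - S (n ∸ a))) relation (sign-square a) ⟩
      sign a * 0ℚ + 1ℚ * (S a - S (n ∸ a))
        ≡⟨ solve 2 (λ s x → s :* con 0ℚ :+ con 1ℚ :* x := x) refl (sign a) (S a - S (n ∸ a)) ⟩
      S a - S (n ∸ a) ∎
      where
      a+b≡n = ℕₚ.m+[n∸m]≡n a≤n
      reflected : binomialSum n (λ m → P₀ (n ∸ m)) a ≡ - S a
      reflected = trans
        (∑<-cong (suc n) (λ { {m} (s≤s m≤n) → trans (cong (_* m choose a) (antisymmetric m≤n))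
          (solve 2 (λ p b → (:- p) :* b := :- (p :* b)) refl (P₀ m) (m choose a)) }))
        (∑<-neg (suc n) (λ m → P₀ m * m choose a))
      relation : P₀ a + sign a * S (n ∸ a) + sign a * - S a ≡ 0ℚ
      relation = begin
        P₀ a + sign a * S (n ∸ a) + sign a * - S a
          ≡⟨ cong₂ (λ s t → P₀ a + s * S (n ∸ a) + sign a * t) (sign-reflect a≤n) reflected ⟨
        P₀ a + sign (n ∸ a) * S (n ∸ a) + sign a * binomialSum n (λ m → P₀ (n ∸ m)) a
          ≡⟨ cong₂ _+_ (cong₂ _+_ (substitute-X,Y p a+b≡n) (substitute-X-Y,X p a+b≡n)) (substitute-Y,Y-X p a+b≡n) ⟨
        (p ⟨ X , Y ⟩ ⊕ p ⟨ X ⊖ Y , X ⟩ ⊕ p ⟨ Y , Y ⊖ X ⟩) a (n ∸ a)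
          ≡⟨ W.three-term (proj₁ p∈W⁻) a (n ∸ a) ⟩
        0ℚ ∎

  derivative-coeff : ∀ {N} (p : Fin (2 ℕ.+ N) → ℚ) (c : Fin (suc N) → ℚ) →
    ∂X (p ⟨ X ⊕ Y , Y ⟩)
      ≈ᴾ ∑ᴾ (λ rs → (fromℕ (N C (rOf rs ∸ 1)) * c rs) ⊙ (X ^ᴾ (rOf rs ∸ 1) ⊛ Y ^ᴾ (sOf rs ∸ 1))) →
    ∀ {x} → x ≤ N → N choose x * extend c x ≡ fromℕ (suc x) * binomialSum (suc N) (extend p) (suc x)
  derivative-coeff {N} p c ∂p≈ {x} x≤N = sym (begin
    fromℕ (suc x) * binomialSum (suc N) (extend p) (suc x)
      ≡⟨ cong (fromℕ (suc x) *_) (substitute-X+Y,Y p (cong suc x+y≡N)) ⟨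
    fromℕ (suc x) * (p ⟨ X ⊕ Y , Y ⟩) (suc x) (N ∸ x)
      ≡⟨ ∂p≈ x (N ∸ x) ⟩
    sum (λ rs → (fromℕ (N C toℕ rs) * c rs) * (X ^ᴾ toℕ rs ⊛ Y ^ᴾ toℕ (opposite rs)) x (N ∸ x))
      ≡⟨ sum-toℕ (λ rs → (fromℕ (N C toℕ rs) * c rs) * (X ^ᴾ toℕ rs ⊛ Y ^ᴾ toℕ (opposite rs)) x (N ∸ x))
           (λ m → (N choose m * extend c m) * (X ^ᴾ m ⊛ Y ^ᴾ (N ∸ m)) x (N ∸ x))
           (λ rs → cong₂ (λ s t → s * (X ^ᴾ toℕ rs ⊛ Y ^ᴾ t) x (N ∸ x))
             (cong₂ _*_ (sym (choose-fromℕ N (toℕ rs))) (sym (extend-toℕ c rs)))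
             (Finₚ.opposite-prop rs)) ⟩
    ∑< (suc N) (λ m → (N choose m * extend c m) * (X ^ᴾ m ⊛ Y ^ᴾ (N ∸ m)) x (N ∸ x))
      ≡⟨ ∑-X^⊛Y^ linear-Y x+y≡N (λ m → N choose m * extend c m) ⟩
    (N choose x * extend c x) * 1ℚ ^ (N ∸ x)
      ≡⟨ cong ((N choose x * extend c x) *_) (1^ (N ∸ x)) ⟩
    (N choose x * extend c x) * 1ℚ
      ≡⟨ ℚₚ.*-identityʳ (N choose x * extend c x) ⟩
    N choose x * extend c x ∎)
    where x+y≡N = ℕₚ.m+[n∸m]≡n x≤N

-- Linear combinations in the formal double zeta space

module _ {w : ℕ} where

  private
    module M = Module (𝒟-module w)
    module ∑ = MonoidSum M.+ᴹ-commutativeMonoid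
    open SetoidReasoning (𝒟-setoid w)

  ∑ᴰ-allFin : ∀ {n} (f : Fin n → 𝒟 w) → ∑ᴰ (allFin n) f ≡ ∑.sum f
  ∑ᴰ-allFin {n} f = trans (cong (foldr _+ᴰ_ 0ᴰ) (map-tabulate {n = n} (λ x → x) f)) (go f)
    where
    go : ∀ {n} (f : Fin n → 𝒟 w) → foldr _+ᴰ_ 0ᴰ (tabulate f) ≡ ∑.sum f
    go {zero}  f = refl
    go {suc n} f = cong (f zero +ᴰ_) (go (f ∘ suc))

  ·-distribˡ-∑ : ∀ {n} a (f : Fin n → 𝒟 w) → a · ∑.sum f ≈ ∑.sum (λ x → a · f x)
  ·-distribˡ-∑ {zero}  a f = ·-zeroʳ a
  ·-distribˡ-∑ {suc n} a f = ≈-trans (·-distribˡ a (f zero) (∑.sum (f ∘ suc)))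
    (+-cong ≈-refl (·-distribˡ-∑ a (f ∘ suc)))

  ·-distribʳ-∑ : ∀ {n} (a : Fin n → ℚ) u → sum a · u ≈ ∑.sum (λ x → a x · u)
  ·-distribʳ-∑ {zero}  a u = ·-zeroˡ u
  ·-distribʳ-∑ {suc n} a u = ≈-trans (·-distribʳ u (a zero) (sum (a ∘ suc)))
    (+-cong ≈-refl (·-distribʳ-∑ (a ∘ suc) u))

  -- Moves the restriction on r from the range into the coefficients: b will be the odd part of e,
  -- which equals e at the admissible r and vanishes at the others.
  ∑ᴰ-filter : ∀ {A : Set} {ℓ} {Q : Pred A ℓ} (Q? : Decidable Q) (a b : A → ℚ) (f : A → 𝒟 w) →
    (∀ {x} → Q x → a x ≡ b x) → (∀ {x} → ¬ Q x → b x ≡ 0ℚ) →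
    ∀ xs → ∑ᴰ (filter Q? xs) (λ x → a x · f x) ≈ ∑ᴰ xs (λ x → b x · f x)
  ∑ᴰ-filter Q? a b f a≡b b≡0 []       = ≈-refl
  ∑ᴰ-filter Q? a b f a≡b b≡0 (x ∷ xs) with Q? x
  ... | yes Qx = +-cong (M.≈ᴹ-reflexive (cong (_· f x) (a≡b Qx))) (∑ᴰ-filter Q? a b f a≡b b≡0 xs)
  ... | no ¬Qx = begin
    ∑ᴰ (filter Q? xs) (λ y → a y · f y)        ≈⟨ ∑ᴰ-filter Q? a b f a≡b b≡0 xs ⟩
    ∑ᴰ xs (λ y → b y · f y)                    ≈⟨ +-identityˡ _ ⟨
    0ᴰ +ᴰ ∑ᴰ xs (λ y → b y · f y)              ≈⟨ +-cong (·-zeroˡ (f x)) ≈-refl ⟨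
    0ℚ · f x +ᴰ ∑ᴰ xs (λ y → b y · f y)        ≈⟨ +-cong (M.≈ᴹ-reflexive (cong (_· f x) (b≡0 ¬Qx))) ≈-refl ⟨
    b x · f x +ᴰ ∑ᴰ xs (λ y → b y · f y)       ∎

  combination : (Index w → ℚ) → 𝒟 w
  combination a = ∑.sum (λ rs → a rs · Z rs)

  combination-cong : ∀ {a b} → (∀ rs → a rs ≡ b rs) → combination a ≈ combination b
  combination-cong a≡b = ∑.sum-cong-≋ (λ rs → M.≈ᴹ-reflexive (cong (_· Z rs) (a≡b rs)))

  combination-+ : ∀ a b → combination a +ᴰ combination b ≈ combination (λ rs → a rs + b rs)
  combination-+ a b = ≈-sym (≈-trans (∑.sum-cong-≋ (λ rs → ·-distribʳ (Z rs) (a rs) (b rs)))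
    (∑.∑-distrib-+ (λ rs → a rs · Z rs) (λ rs → b rs · Z rs)))

  combination-sum : ∀ {n} (a : Fin n → ℚ) (b : Fin n → Index w → ℚ) →
    ∑.sum (λ i → a i · combination (b i)) ≈ combination (λ rs → sum (λ i → a i * b i rs))
  combination-sum a b = begin
    ∑.sum (λ i → a i · combination (b i))
      ≈⟨ ∑.sum-cong-≋ (λ i → ≈-trans (·-distribˡ-∑ (a i) (λ rs → b i rs · Z rs))
           (∑.sum-cong-≋ (λ rs → ≈-sym (·-assoc (a i) (b i rs) (Z rs))))) ⟩
    ∑.sum (λ i → ∑.sum (λ rs → (a i * b i rs) · Z rs))
      ≈⟨ ∑.∑-comm (λ i rs → (a i * b i rs) · Z rs) ⟩
    ∑.sum (λ rs → ∑.sum (λ i → (a i * b i rs) · Z rs))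
      ≈⟨ ∑.sum-cong-≋ (λ rs → ·-distribʳ-∑ (λ i → a i * b i rs) (Z rs)) ⟨
    combination (λ rs → sum (λ i → a i * b i rs)) ∎

  combination-swap : ∀ a → ∑.sum (λ rs → a rs · Z (swap rs)) ≈ combination (a ∘ swap)
  combination-swap a = ≈-trans (∑.sum-permute (λ rs → a rs · Z (swap rs)) Perm.reverse)
    (∑.sum-cong-≋ (λ rs → M.≈ᴹ-reflexive (cong (λ x → a (swap rs) · Z x) (Finₚ.opposite-involutive rs))))

  -- Eliminates `P ij` between the two defining relations.
  double-shuffle : ∀ ij →
    combination (λ rs → fromℕ (shuffleCoeff ij rs)) ≈ Z ij +ᴰ Z (swap ij) +ᴰ Zʷ
  double-shuffle ij = begin
    combination (λ rs → fromℕ (shuffleCoeff ij rs))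
      ≡⟨ ∑ᴰ-allFin (λ rs → fromℕ (shuffleCoeff ij rs) · Z rs) ⟨
    ∑ᴰ (pairs w) (λ rs → fromℕ (shuffleCoeff ij rs) · Z rs)
      ≈⟨ shuffle ij ⟩
    P ij
      ≈⟨ +-identityʳ (P ij) ⟨
    P ij +ᴰ 0ᴰ
      ≈⟨ +-cong ≈-refl (+-inverseˡ Zʷ) ⟨
    P ij +ᴰ (-ᴰ Zʷ +ᴰ Zʷ)
      ≈⟨ +-assoc (P ij) (-ᴰ Zʷ) Zʷ ⟨
    P ij +ᴰ -ᴰ Zʷ +ᴰ Zʷ
      ≈⟨ +-cong (stuffle ij) ≈-refl ⟨
    Z ij +ᴰ Z (swap ij) +ᴰ Zʷ ∎

  weighted-relation : ∀ (a : Index w → ℚ) →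
    combination (λ rs → sum (λ ij → a ij * fromℕ (shuffleCoeff ij rs)))
      ≈ combination (λ rs → a rs + a (swap rs)) +ᴰ sum a · Zʷ
  weighted-relation a = begin
    combination (λ rs → sum (λ ij → a ij * fromℕ (shuffleCoeff ij rs)))
      ≈⟨ combination-sum a (λ ij rs → fromℕ (shuffleCoeff ij rs)) ⟨
    ∑.sum (λ ij → a ij · combination (λ rs → fromℕ (shuffleCoeff ij rs)))
      ≈⟨ ∑.sum-cong-≋ (λ ij → ≈-trans (·-cong (a ij) (double-shuffle ij))
           (≈-trans (·-distribˡ (a ij) (Z ij +ᴰ Z (swap ij)) Zʷ)
             (+-cong (·-distribˡ (a ij) (Z ij) (Z (swap ij))) ≈-refl))) ⟩
    ∑.sum (λ ij → a ij · Z ij +ᴰ a ij · Z (swap ij) +ᴰ a ij · Zʷ)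
      ≈⟨ ∑.∑-distrib-+ (λ ij → a ij · Z ij +ᴰ a ij · Z (swap ij)) (λ ij → a ij · Zʷ) ⟩
    ∑.sum (λ ij → a ij · Z ij +ᴰ a ij · Z (swap ij)) +ᴰ ∑.sum (λ ij → a ij · Zʷ)
      ≈⟨ +-cong (∑.∑-distrib-+ (λ ij → a ij · Z ij) (λ ij → a ij · Z (swap ij)))
                (≈-sym (·-distribʳ-∑ a Zʷ)) ⟩
    combination a +ᴰ ∑.sum (λ ij → a ij · Z (swap ij)) +ᴰ sum a · Zʷ
      ≈⟨ +-cong (+-cong ≈-refl (combination-swap a)) ≈-refl ⟩
    combination a +ᴰ combination (a ∘ swap) +ᴰ sum a · Zʷ
      ≈⟨ +-cong (combination-+ a (a ∘ swap)) ≈-refl ⟩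
    combination (λ rs → a rs + a (swap rs)) +ᴰ sum a · Zʷ ∎

  +ᴰ-cancelˡ : ∀ t {u v : 𝒟 w} → t +ᴰ u ≈ t +ᴰ v → u ≈ v
  +ᴰ-cancelˡ t {u} {v} = GroupProperties.∙-cancelˡ M.+ᴹ-group t u v

-- The relation attached to a self-dual sequence

opaque
  -- The factor ½ (1 - (-1)ˣ) is the indicator of odd x, that is, of even r = x + 1.
  oddPart : (ℕ → ℚ) → ℕ → ℚ
  oddPart e x = ½ * (1ℚ - sign x) * e x

  oddPart-def : ∀ e x → oddPart e x ≡ ½ * (1ℚ - sign x) * e x
  oddPart-def e x = refl

module _ {N : ℕ} (N-odd : sign N ≡ - 1ℚ) {e : ℕ → ℚ} (e-selfDual : SelfDual N e) where

  open SelfDual e-selfDual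

  private
    -- One ½ makes up for the doubling that the symmetry i ↦ N - i causes on both sides of the
    -- relation; the other is the ½ of the projection in `oddPart`.
    weight : ℕ → ℚ
    weight i = ½ * (½ * (sign i * e i))

    weight-sym : ∀ {i} → i ≤ N → weight (N ∸ i) ≡ weight i
    weight-sym {i} i≤N = cong (λ t → ½ * (½ * t)) (begin
      sign (N ∸ i) * e (N ∸ i)    ≡⟨ cong₂ _*_ (trans (sign-∸ i≤N) (cong (_* sign i) N-odd)) (antisym i≤N) ⟩
      - 1ℚ * sign i * - e i       ≡⟨ solve 2 (λ s e → con (- 1ℚ) :* s :* (:- e) := s :* e) refl (sign i) (e i) ⟩
      sign i * e i                ∎)
      where open ≡-Reasoning

    weighted-choose : ∀ {r} → r ≤ N → ∑< (suc N) (λ i → weight i * r choose i) ≡ ½ * (½ * e r)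
    weighted-choose {r} r≤N = begin
      ∑< (suc N) (λ i → weight i * r choose i)
        ≡⟨ ∑<-cong (suc N) (λ {i} _ → solve 2 (λ x c → con ½ :* (con ½ :* x) :* c := con ½ :* con ½ :* (c :* x)) refl
             (sign i * e i) (r choose i)) ⟩
      ∑< (suc N) (λ i → ½ * ½ * (r choose i * (sign i * e i)))
        ≡⟨ ∑<-*ˡ (suc N) (½ * ½) (λ i → r choose i * (sign i * e i)) ⟩
      ½ * ½ * ∑< (suc N) (λ i → r choose i * (sign i * e i))
        ≡⟨ cong (½ * ½ *_) (self-dual r≤N) ⟩
      ½ * ½ * e r
        ≡⟨ ℚₚ.*-assoc ½ ½ (e r) ⟩
      ½ * (½ * e r) ∎
      where open ≡-Reasoning

    weighted-shuffle : ∀ (rs : Fin (suc N)) →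
      sum (λ ij → weight (toℕ ij) * fromℕ (shuffleCoeff ij rs)) ≡ ½ * e (toℕ rs)
    weighted-shuffle rs = begin
      sum (λ ij → weight (toℕ ij) * fromℕ (shuffleCoeff ij rs))
        ≡⟨ sum-toℕ (λ ij → weight (toℕ ij) * fromℕ (shuffleCoeff ij rs))
             (λ i → a i + b i) (λ ij → begin
               weight (toℕ ij) * fromℕ (r C toℕ ij ℕ.+ r C toℕ (opposite ij))
                 ≡⟨ cong (λ t → weight (toℕ ij) * t) (fromℕ-+ (r C toℕ ij) (r C toℕ (opposite ij))) ⟩
               weight (toℕ ij) * (fromℕ (r C toℕ ij) + fromℕ (r C toℕ (opposite ij)))
                 ≡⟨ cong₂ (λ s t → weight (toℕ ij) * (s + t)) (choose-fromℕ r (toℕ ij)) (choose-fromℕ r (toℕ (opposite ij))) ⟨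
               weight (toℕ ij) * (r choose toℕ ij + r choose toℕ (opposite ij))
                 ≡⟨ cong (λ t → weight (toℕ ij) * (r choose toℕ ij + r choose t)) (Finₚ.opposite-prop ij) ⟩
               weight (toℕ ij) * (r choose toℕ ij + r choose (N ∸ toℕ ij))
                 ≡⟨ ℚₚ.*-distribˡ-+ (weight (toℕ ij)) (r choose toℕ ij) (r choose (N ∸ toℕ ij)) ⟩
               a (toℕ ij) + b (toℕ ij) ∎) ⟩
      ∑< (suc N) (λ i → a i + b i)
        ≡⟨ ∑<-+ (suc N) a b ⟩
      ∑< (suc N) a + ∑< (suc N) b
        -- Reflecting i ↦ N - i fixes the weights and carries the second binomial of the shuffle
        -- coefficient to the first.
        ≡⟨ cong (∑< (suc N) a +_) (trans (∑<-reverse N b) (∑<-cong (suc N) (λ { {i} (s≤s i≤N) →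
             cong₂ (λ s t → s * r choose t) (weight-sym i≤N) (ℕₚ.m∸[m∸n]≡n i≤N) }))) ⟩
      ∑< (suc N) a + ∑< (suc N) a
        ≡⟨ cong₂ _+_ (weighted-choose r≤N) (weighted-choose r≤N) ⟩
      ½ * (½ * e r) + ½ * (½ * e r)
        ≡⟨ solve 1 (λ x → con ½ :* (con ½ :* x) :+ con ½ :* (con ½ :* x) := con ½ :* x) refl (e r) ⟩
      ½ * e r ∎
      where
      open ≡-Reasoning
      r = toℕ rs
      r≤N = Finₚ.toℕ≤pred[n] rs
      a b : ℕ → ℚ
      a i = weight i * r choose i
      b i = weight i * r choose (N ∸ i)

  self-dual-relation : ∃[ q ]
    combination {2 ℕ.+ N} (oddPart e ∘ toℕ) ≈ q · Zʷ {2 ℕ.+ N}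
  -- Each relation contributes one `Zʷ`, so q is the total weight. The stuffle part, with
  -- coefficients ½ (-1)ˣ e(x), is added to both sides and cancelled.
  self-dual-relation = sum a , +ᴰ-cancelˡ (combination (λ rs → a rs + a (swap rs))) (begin
    combination (λ rs → a rs + a (swap rs)) +ᴰ combination (oddPart e ∘ toℕ)
      ≈⟨ combination-+ (λ rs → a rs + a (swap rs)) (oddPart e ∘ toℕ) ⟩
    combination (λ rs → a rs + a (swap rs) + oddPart e (toℕ rs))
      ≈⟨ combination-cong (λ rs → trans (coefficient rs) (sym (weighted-shuffle rs))) ⟩
    combination (λ rs → sum (λ ij → a ij * fromℕ (shuffleCoeff ij rs)))
      ≈⟨ weighted-relation a ⟩
    combination (λ rs → a rs + a (swap rs)) +ᴰ sum a · Zʷ ∎)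
    where
    open SetoidReasoning (𝒟-setoid (2 ℕ.+ N))
    a : Fin (suc N) → ℚ
    a = weight ∘ toℕ
    coefficient : ∀ rs → a rs + a (swap rs) + oddPart e (toℕ rs) ≡ ½ * e (toℕ rs)
    coefficient rs = trans
      (cong₂ (λ s t → a rs + s + t)
        (trans (cong weight (Finₚ.opposite-prop rs)) (weight-sym (Finₚ.toℕ≤pred[n] rs)))
        (oddPart-def e (toℕ rs)))
      (solve 2 (λ s e → con ½ :* (con ½ :* (s :* e)) :+ con ½ :* (con ½ :* (s :* e)) :+ con ½ :* (con 1ℚ :- s) :* e
                 := con ½ :* e) refl (sign (toℕ rs)) (e (toℕ rs)))

-- Parity of r and the end terms

sign-2+ : ∀ n → sign (2 ℕ.+ n) ≡ sign n
sign-2+ n = solve 1 (λ s → :- (:- s) := s) refl (sign n)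

sign-even : ∀ {n} → 2 ∣ n → sign n ≡ 1ℚ
sign-even (divides zero    refl) = refl
sign-even (divides (suc q) refl) = trans (sign-2+ (q ℕ.* 2)) (sign-even (divides q refl))

sign-odd : ∀ {n} → ¬ 2 ∣ n → sign n ≡ - 1ℚ
sign-odd {zero}        2∤n = contradiction (2 ∣0) 2∤n
sign-odd {suc zero}    2∤n = refl
sign-odd {suc (suc n)} 2∤n = trans (sign-2+ n) (sign-odd (2∤n ∘ ∣m∣n⇒∣m+n ∣-refl))

module _ {N′ : ℕ} (N-odd : sign (suc N′) ≡ - 1ℚ) {e : ℕ → ℚ} (e-selfDual : SelfDual (suc N′) e) where

  open SelfDual e-selfDual

  private
    -- N′ is k - 4, the upper end of the range of r.
    Admissible : ℕ → Set
    Admissible r = 4 ≤ r × r ≤ N′ × 2 ∣ r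

    h : ℕ → ℚ
    h = oddPart e

    -- Parity is tested on r = suc x while `oddPart` is written in x, hence 1 + s in place of 1 - s.
    h-sign : ∀ x {s} → sign (suc x) ≡ s → h x ≡ ½ * (1ℚ + s) * e x
    h-sign x refl = trans (oddPart-def e x)
      (solve 2 (λ s e → con ½ :* (con 1ℚ :- s) :* e := con ½ :* (con 1ℚ :+ :- s) :* e) refl (sign x) (e x))

    h-odd : ∀ x → sign (suc x) ≡ - 1ℚ → h x ≡ 0ℚ
    h-odd x s≡-1 = trans (h-sign x s≡-1)
      (solve 1 (λ e → con ½ :* (con 1ℚ :+ con (- 1ℚ)) :* e := con 0ℚ) refl (e x))

    h-vanish : ∀ x → e x ≡ 0ℚ → h x ≡ 0ℚ
    h-vanish x e≡0 = trans (oddPart-def e x)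
      (trans (cong (½ * (1ℚ - sign x) *_) e≡0) (ℚₚ.*-zeroʳ (½ * (1ℚ - sign x))))

    h-admissible : ∀ x → 2 ∣ suc x → e x ≡ h x
    h-admissible x 2∣r = sym (trans (h-sign x (sign-even 2∣r))
      (solve 1 (λ e → con ½ :* (con 1ℚ :+ con 1ℚ) :* e := e) refl (e x)))

    h-small : ∀ x → ¬ 4 ≤ suc x → h x ≡ 0ℚ
    h-small 0 _ = h-vanish 0 e[0]≡0
    -- This is r = 2, where parity does not help and e(1) = 0 is essential.
    h-small 1 _ = h-vanish 1 (e[1]≡0 (s≤s z≤n))
    h-small 2 _ = h-odd 2 refl
    h-small (suc (suc (suc _))) 4≰r = contradiction (s≤s (s≤s (s≤s (s≤s z≤n)))) 4≰r

    -- Above the range lie only r = k - 3, which is odd, and r = k - 2, where x = N and e(N) = 0.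
    h-large : ∀ x → x ≤ suc N′ → ¬ suc x ≤ N′ → h x ≡ 0ℚ
    h-large x x≤N r≰N′ with ℕₚ.m≤n⇒m<n∨m≡n x≤N
    ... | inj₂ x≡N = h-vanish x (trans (cong e x≡N) e[N]≡0)
    ... | inj₁ x<N = h-odd x (subst (λ t → sign t ≡ - 1ℚ) (ℕₚ.≤-antisym (ℕₚ.≰⇒> r≰N′) x<N) N-odd)

    h-inadmissible : ∀ x → x ≤ suc N′ → ¬ Admissible (suc x) → h x ≡ 0ℚ
    h-inadmissible x x≤N ¬Q = cases (4 ≤? suc x) (suc x ≤? N′) (2 ∣? suc x)
      where
      cases : Dec (4 ≤ suc x) → Dec (suc x ≤ N′) → Dec (2 ∣ suc x) → h x ≡ 0ℚ
      cases (no 4≰r)  _           _         = h-small x 4≰r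
      cases (yes _)   (no r≰N′)   _         = h-large x x≤N r≰N′
      cases (yes _)   (yes _)     (no 2∤r)  = h-odd x (sign-odd 2∤r)
      cases (yes 4≤r) (yes r≤N′)  (yes 2∣r) = contradiction (4≤r , r≤N′ , 2∣r) ¬Q

  ∑ᴰ-admissible : (a : Fin (2 ℕ.+ N′) → ℚ) → (∀ rs → a rs ≡ e (toℕ rs)) → ∀ xs →
    ∑ᴰ (filter (λ rs → 4 ≤? rOf rs ×-dec rOf rs ≤? N′ ×-dec 2 ∣? rOf rs) xs) (λ rs → a rs · Z {3 ℕ.+ N′} rs)
      ≈ ∑ᴰ xs (λ rs → h (toℕ rs) · Z rs)
  ∑ᴰ-admissible a a≡e = ∑ᴰ-filter (λ rs → 4 ≤? rOf rs ×-dec rOf rs ≤? N′ ×-dec 2 ∣? rOf rs) a (h ∘ toℕ) Z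
    (λ { {rs} (_ , _ , 2∣r) → trans (a≡e rs) (h-admissible (toℕ rs) 2∣r) })
    (λ {rs} → h-inadmissible (toℕ rs) (Finₚ.toℕ≤pred[n] rs))

  ∑ᴰ-oddPart : ∃[ q ] ∑ᴰ (pairs (3 ℕ.+ N′)) (λ rs → h (toℕ rs) · Z rs) ≈ q · Zʷ {3 ℕ.+ N′}
  ∑ᴰ-oddPart = proj₁ relation , subst (_≈ proj₁ relation · Zʷ)
    (sym (∑ᴰ-allFin {3 ℕ.+ N′} {2 ℕ.+ N′} (λ rs → h (toℕ rs) · Z rs))) (proj₂ relation)
    where relation = self-dual-relation N-odd e-selfDual

theorem3 : ∀ (k : ℕ) → 12 ≤ k → 2 ∣ k →
    ∀ (p : V k) → p ∈ W⁻ k →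
    ∀ (c : Index (k ∸ 1) → ℚ) →
    ∂X (p ⟨ X ⊕ Y , Y ⟩)
    ≈ᴾ ∑ᴾ (λ rs → (fromℕ ((k ∸ 3) C (rOf rs ∸ 1)) * c rs)
    ⊙ (X ^ᴾ (rOf rs ∸ 1) ⊛ Y ^ᴾ (sOf rs ∸ 1))) →
    ∃[ q ]
    ∑ᴰ (filter (λ rs → 4 ≤? rOf rs ×-dec rOf rs ≤? k ∸ 4 ×-dec 2 ∣? rOf rs)
    (pairs (k ∸ 1)))
    (λ rs → (c rs - c (swap rs)) · Z rs)
    ≈ q · Zʷ {k ∸ 1}
-- With k = N′ + 4 the differences k ∸ 1, k ∸ 2, k ∸ 3 and k ∸ 4 compute, so the index types agree
-- definitionally.
theorem3 (suc (suc (suc (suc N′)))) _ 2∣k p p∈W⁻ c ∂p≈ =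
  proj₁ relation , ≈-trans
    (∑ᴰ-admissible N-odd selfDual (λ rs → c rs - c (swap rs)) (λ rs → sym (cong₂ _-_
      (extend-toℕ c rs)
      (trans (cong (extend c) (sym (Finₚ.opposite-prop rs))) (extend-toℕ c (swap rs)))))
      (pairs (2 ℕ.+ N)))
    (proj₂ relation)
  where
  N = suc N′
  n-even : sign (suc N) ≡ 1ℚ
  n-even = trans (sym (sign-2+ (suc N))) (sign-even 2∣k)
  N-odd : sign N ≡ - 1ℚ
  N-odd = trans (solve 1 (λ s → s := :- (:- s)) refl (sign N)) (cong -_ n-even)
  selfDual : SelfDual N (antisymmetrize N (extend c))
  selfDual = Coefficients.selfDual N N-odd (extend p)
    (PeriodPolynomial.even n-even p p∈W⁻) (PeriodPolynomial.period n-even p p∈W⁻)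
    (extend c) (derivative-coeff p c ∂p≈)
  relation = ∑ᴰ-oddPart N-odd selfDual
theorem3 (suc zero)             (s≤s ())
theorem3 (suc (suc zero))       (s≤s (s≤s ()))
theorem3 (suc (suc (suc zero))) (s≤s (s≤s (s≤s ())))
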